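{- Let $A$ be a quadriculated annulus admitting at least one domino tiling, let $\xi$ be a cut of $A$, and let $f_{\max}$ and $f_{\min}$ be the maximum and minimum values of the flux $\phi(t,\xi)$ among all tilings $t$ of $A$. Then there exist cuts $\xi_{\max}$ and $\xi_{\min}$ of $A$ such that no tiling of flux $f_{\max}$ trespasses $\xi_{\max}$ and no tiling of flux $f_{\min}$ trespasses $\xi_{\min}$.
   Context: A quadriculated annulus $A$ is a compact surface homeomorphic to $S^1\times[0,1]$, embedded in $\mathbb{R}^2$, obtained by gluing unit squares along sides so that interior vertices belong to exactly four squares; its squares are colored black and white with side-adjacent squares of opposite colors. A cut is a simple path of vertices of $A$ (consecutive vertices joined by sides of squares) going from the outer boundary to the inner boundary and having exactly one vertex on each boundary component. In each domino of a tiling draw the arrow from its black square to its white square. The flux $\phi(t,\xi)$ of a tiling $t$ relative to a cut $\xi$ is the number of domino arrows crossing $\xi$ counterclockwise (around the hole of $A$) minus the number crossing $\xi$ clockwise. A tiling trespasses a cut if some domino of the tiling has its two squares sharing an edge of the cut. -}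

module Defs where

open import Data.Nat using (ℕ; zero; suc; _+_)
open import Data.Integer using (ℤ; 0ℤ; 1ℤ; -1ℤ) renaming (_+_ to _+ℤ_)
open import Data.Fin using (Fin; zero; suc; inject₁; fromℕ; _≟_)
open import Data.Bool using (Bool; true; false; if_then_else_; _∧_)
open import Data.Product using (Σ; _×_; _,_; ∃)
open import Data.Sum using (_⊎_)
open import Relation.Nullary using (¬_)
open import Relation.Nullary.Decidable using (⌊_⌋)
open import Relation.Binary.PropositionalEquality using (_≡_; _≢_)
open import Relation.Binary.Construct.Closure.ReflexiveTransitive using (Star)

sumℕ : (n : ℕ) → (Fin n → ℕ) → ℕ
sumℕ zero    g = 0
sumℕ (suc n) g = g zero + sumℕ n (λ i → g (suc i))

sumℤ : (n : ℕ) → (Fin n → ℤ) → ℤ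
sumℤ zero    g = 0ℤ
sumℤ (suc n) g = g zero +ℤ sumℤ n (λ i → g (suc i))

count : (n : ℕ) → (Fin n → Bool) → ℕ
count n p = sumℕ n (λ i → if p i then 1 else 0)

next : Fin 4 → Fin 4
next zero = suc zero
next (suc zero) = suc (suc zero)
next (suc (suc zero)) = suc (suc (suc zero))
next (suc (suc (suc zero))) = zero

prev : Fin 4 → Fin 4
prev zero = suc (suc (suc zero))
prev (suc zero) = zero
prev (suc (suc zero)) = suc zero
prev (suc (suc (suc zero))) = suc (suc zero)

-- Raw data of a finite square complex with a chosen planar picture.
--  * squares are Fin nF, edges Fin nE, vertices Fin nV;
--  * corner f 0..3 are the corners of square f in COUNTERCLOCKWISE order
--    (orientation of the plane);
--  * side f a is the edge of square f joining corner f a to corner f (next a);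
--  * src/tgt are the two endpoints of an edge (a reference orientation);
--  * black f says whether square f is black (otherwise white);
--  * outer v marks which boundary component is the OUTER one (only
--    meaningful on boundary vertices).

record QuadComplex : Set where
  field
    nV nE nF : ℕ
    corner   : Fin nF → Fin 4 → Fin nV
    side     : Fin nF → Fin 4 → Fin nE
    src tgt  : Fin nE → Fin nV
    black    : Fin nF → Bool
    outer    : Fin nV → Bool

module _ (A : QuadComplex) where
  open QuadComplex A

  sideCount : Fin nE → ℕ
  sideCount e = sumℕ nF (λ f → count 4 (λ a → ⌊ side f a ≟ e ⌋))

  cornerCount : Fin nV → ℕ
  cornerCount v = sumℕ nF (λ f → count 4 (λ a → ⌊ corner f a ≟ v ⌋))

  BoundaryEdge : Fin nE → Set
  BoundaryEdge e = sideCount e ≡ 1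

  InteriorEdge : Fin nE → Set
  InteriorEdge e = sideCount e ≡ 2

  Joins : Fin nE → Fin nV → Fin nV → Set
  Joins e u v = (src e ≡ u × tgt e ≡ v) ⊎ (src e ≡ v × tgt e ≡ u)

  BoundaryVertex : Fin nV → Set
  BoundaryVertex v = ∃ λ e → BoundaryEdge e × (src e ≡ v ⊎ tgt e ≡ v)

  OuterBoundaryVertex : Fin nV → Set
  OuterBoundaryVertex v = BoundaryVertex v × outer v ≡ true

  InnerBoundaryVertex : Fin nV → Set
  InnerBoundaryVertex v = BoundaryVertex v × outer v ≡ false

  BoundaryAdj : Fin nV → Fin nV → Set
  BoundaryAdj u v = ∃ λ e → BoundaryEdge e × Joins e u v

  DualAdj : Fin nF → Fin nF → Set
  DualAdj f g = ∃ λ a → ∃ λ b → side f a ≡ side g b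

  LinkAdj : Fin nV → (Fin nF × Fin 4) → (Fin nF × Fin 4) → Set
  LinkAdj v (f , a) (g , b) =
    corner f a ≡ v × corner g b ≡ v ×
    (side f a ≡ side g (prev b) ⊎ side g b ≡ side f (prev a))

  -- A is a quadriculated annulus (with the given orientation, outer
  -- boundary and black/white colouring).  The topological condition
  -- "homeomorphic to S¹ × [0,1]" is expressed combinatorially: the complex
  -- is a surface (every edge in one or two squares, connected vertex links),
  -- oriented (shared edges traversed in opposite directions), connected,
  -- has Euler characteristic 0 and exactly two boundary components.
  record IsQuadAnnulus : Set where
    field
      corners-distinct : ∀ f a b → corner f a ≡ corner f b → a ≡ b
      side-joins       : ∀ f a → Joins (side f a) (corner f a) (corner f (next a))
      edge-sides       : ∀ e → BoundaryEdge e ⊎ InteriorEdge e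
      oriented         : ∀ f a g b → side f a ≡ side g b → f ≢ g →
                           corner f a ≡ corner g (next b)
      vertex-used      : ∀ v → ∃ λ f → ∃ λ a → corner f a ≡ v
      link-connected   : ∀ v f a g b → corner f a ≡ v → corner g b ≡ v →
                           Star (λ x y → LinkAdj v x y ⊎ LinkAdj v y x) (f , a) (g , b)
      interior-four    : ∀ v → ¬ BoundaryVertex v → cornerCount v ≡ 4
      connected        : ∀ f g → Star DualAdj f g
      euler-zero       : nV + nF ≡ nE
      boundary-labels  : ∀ u v → BoundaryAdj u v → outer u ≡ outer v
      outer-nonempty   : ∃ λ v → OuterBoundaryVertex v
      inner-nonempty   : ∃ λ v → InnerBoundaryVertex v
      outer-connected  : ∀ u v → OuterBoundaryVertex u → OuterBoundaryVertex v →
                           Star BoundaryAdj u v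
      inner-connected  : ∀ u v → InnerBoundaryVertex u → InnerBoundaryVertex v →
                           Star BoundaryAdj u v
      colouring        : ∀ f a g b → side f a ≡ side g b → f ≢ g → black f ≢ black g

  -- A domino tiling = a perfect matching of the dual graph: the set of
  -- "middle" edges of the dominoes.  Each selected edge is interior and every
  -- square has exactly one selected side.
  record Tiling : Set where
    field
      sel          : Fin nE → Bool
      sel-interior : ∀ e → sel e ≡ true → InteriorEdge e
      one-per-sq   : ∀ f → count 4 (λ a → sel (side f a)) ≡ 1

  record Cut : Set where
    field
      len           : ℕ
      vtx           : Fin (suc len) → Fin nV
      edg           : Fin len → Fin nE
      edg-joins     : ∀ i → Joins (edg i) (vtx (inject₁ i)) (vtx (suc i))
      simple        : ∀ i j → vtx i ≡ vtx j → i ≡ j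
      starts-outer  : OuterBoundaryVertex (vtx zero)
      ends-inner    : InnerBoundaryVertex (vtx (fromℕ len))
      only-endpoints : ∀ i → BoundaryVertex (vtx i) → i ≡ zero ⊎ i ≡ fromℕ len

  -- Flux.  Orient the i-th cut edge from vtx i to vtx (i+1) (outer towards
  -- inner).  The square to its left is the square f with side f a = edg i
  -- and corner f a = vtx i (corners are listed counterclockwise).  The
  -- domino arrow (black → white) crosses counterclockwise around the hole
  -- exactly when it goes from the left square to the right square, i.e. when
  -- the left square is black: contribution +1; otherwise −1.
  flux : Tiling → Cut → ℤ
  flux t ξ = sumℤ len (λ i → sumℤ nF (λ f → sumℤ 4 (λ a →
      if sel (edg i) ∧ ⌊ side f a ≟ edg i ⌋ ∧ ⌊ corner f a ≟ vtx (inject₁ i) ⌋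
      then (if black f then 1ℤ else -1ℤ)
      else 0ℤ)))
    where open Tiling t
          open Cut ξ

  Trespasses : Tiling → Cut → Set
  Trespasses t ξ = ∃ λ i → Tiling.sel t (Cut.edg ξ i) ≡ true

{-# OPTIONS --safe #-}
module Submission where

-- Direct every edge with its white square on the left. Adding 4 to the height function
-- of a tiling t on a set of vertices containing the inner boundary and avoiding the outer
-- one gives the height function of a tiling of larger flux, provided the set is closed
-- under following unselected edges backwards. Hence when the flux can no longer be raised,
-- a directed path of unselected edges leads from the outer to the inner boundary: a cut
-- relative to which t has flux 0, while the flux of any tiling relative to it is minus the
-- number of dominoes lying across it. The difference of the fluxes of two tilings does not
-- depend on the cut, so no tiling of maximal flux trespasses this one. That independence
-- says that the difference cocycle of two tilings has a potential; it follows from a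
-- dimension count using Euler characteristic 0. The minimum is the maximum after
-- exchanging the two colours.

open import Defs
open import Data.Nat as ℕ using (ℕ; zero; suc)
import Data.Nat.Properties as ℕ
open import Data.Integer as ℤ using (ℤ; +_; 0ℤ; 1ℤ; -1ℤ; _+_; _*_; _-_; -_; _≤_)
import Data.Integer.Properties as ℤ
open import Data.Integer.Tactic.RingSolver using (solve-∀)
open import Data.Fin using (Fin; zero; suc; inject₁; fromℕ; punchIn; punchOut; splitAt; _↑ˡ_; _↑ʳ_; _≟_)
open import Data.Fin.Properties using (any?; punchIn-punchOut; splitAt-↑ˡ; splitAt-↑ʳ; splitAt⁻¹-↑ˡ; splitAt⁻¹-↑ʳ; suc-injective)
open import Data.Bool as Bool using (Bool; true; false; not; _∧_; _∨_; _xor_; if_then_else_)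
open import Data.Bool.Properties using (¬-not; not-injective; xor-same; ∨-zeroʳ)
open import Data.Product using (Σ; ∃; _×_; _,_; proj₁; proj₂)
open import Data.Sum using (_⊎_; inj₁; inj₂; [_,_]′)
open import Data.Empty using (⊥-elim)
open import Function using (_∘_)
open import Relation.Nullary using (¬_; Dec; yes; no)
open import Relation.Nullary.Decidable using (⌊_⌋; ¬?; _×-dec_; _⊎-dec_; decidable-stable)
open import Relation.Binary.PropositionalEquality
open import Relation.Binary.Construct.Closure.ReflexiveTransitive using (Star; ε; _◅_)
open ≡-Reasoning

-- Decision procedures and finite integer sums.

⌊⌋≡true : ∀ {p} {P : Set p} (d : Dec P) → P → ⌊ d ⌋ ≡ true
⌊⌋≡true (yes _) _ = refl
⌊⌋≡true (no ¬p) p = ⊥-elim (¬p p)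

⌊⌋≡false : ∀ {p} {P : Set p} (d : Dec P) → ¬ P → ⌊ d ⌋ ≡ false
⌊⌋≡false (yes p) ¬p = ⊥-elim (¬p p)
⌊⌋≡false (no _) _ = refl

if-yes : ∀ {p a} {P : Set p} {X : Set a} {x y : X} (d : Dec P) → P → (if ⌊ d ⌋ then x else y) ≡ x
if-yes {x = x} {y} d p = cong (λ b → if b then x else y) (⌊⌋≡true d p)

if-no : ∀ {p a} {P : Set p} {X : Set a} {x y : X} (d : Dec P) → ¬ P → (if ⌊ d ⌋ then x else y) ≡ y
if-no {x = x} {y} d ¬p = cong (λ b → if b then x else y) (⌊⌋≡false d ¬p)

⟦_⟧ : Bool → ℤ
⟦ b ⟧ = if b then 1ℤ else 0ℤ

sign : Bool → ℤ
sign b = if b then 1ℤ else -1ℤ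

sum-cong : ∀ n {g h : Fin n → ℤ} → (∀ i → g i ≡ h i) → sumℤ n g ≡ sumℤ n h
sum-cong zero    eq = refl
sum-cong (suc n) eq = cong₂ _+_ (eq zero) (sum-cong n (eq ∘ suc))

sum-zero : ∀ n {h : Fin n → ℤ} → (∀ i → h i ≡ 0ℤ) → sumℤ n h ≡ 0ℤ
sum-zero zero    eq = refl
sum-zero (suc n) eq = cong₂ _+_ (eq zero) (sum-zero n (eq ∘ suc))

sum-+ : ∀ n (g h : Fin n → ℤ) → sumℤ n (λ i → g i + h i) ≡ sumℤ n g + sumℤ n h
sum-+ zero    g h = refl
sum-+ (suc n) g h = trans (cong (_+_ (g zero + h zero)) (sum-+ n (g ∘ suc) (h ∘ suc)))
                          (interchange (g zero) (h zero) _ _)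
  where
  interchange : ∀ a b c d → a + b + (c + d) ≡ a + c + (b + d)
  interchange = solve-∀

sum-*ˡ : ∀ n c (h : Fin n → ℤ) → sumℤ n (λ i → c * h i) ≡ c * sumℤ n h
sum-*ˡ zero    c h = sym (ℤ.*-zeroʳ c)
sum-*ˡ (suc n) c h = trans (cong (_+_ (c * h zero)) (sum-*ˡ n c (h ∘ suc)))
                           (sym (ℤ.*-distribˡ-+ c (h zero) _))

sum-*ʳ : ∀ n c (h : Fin n → ℤ) → sumℤ n (λ i → h i * c) ≡ sumℤ n h * c
sum-*ʳ n c h = trans (sum-cong n (λ i → ℤ.*-comm (h i) c))
                     (trans (sum-*ˡ n c h) (ℤ.*-comm c _))

sum-neg : ∀ n (h : Fin n → ℤ) → sumℤ n (λ i → - h i) ≡ - sumℤ n h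
sum-neg zero    h = refl
sum-neg (suc n) h = trans (cong (_+_ (- h zero)) (sum-neg n (h ∘ suc)))
                          (sym (ℤ.neg-distrib-+ (h zero) _))

sum-minus : ∀ n (g h : Fin n → ℤ) → sumℤ n (λ i → g i - h i) ≡ sumℤ n g - sumℤ n h
sum-minus n g h = trans (sum-+ n g (λ i → - h i)) (cong (_+_ (sumℤ n g)) (sum-neg n h))

sum-swap : ∀ n m (h : Fin n → Fin m → ℤ) →
           sumℤ n (λ i → sumℤ m (h i)) ≡ sumℤ m (λ j → sumℤ n (λ i → h i j))
sum-swap zero    m h = sym (sum-zero m (λ _ → refl))
sum-swap (suc n) m h = trans (cong (_+_ (sumℤ m (h zero))) (sum-swap n m (h ∘ suc)))
                             (sym (sum-+ m (h zero) _))

sum-single : ∀ n (h : Fin n → ℤ) i → (∀ j → j ≢ i → h j ≡ 0ℤ) → sumℤ n h ≡ h i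
sum-single (suc n) h zero    off =
  trans (cong (_+_ (h zero)) (sum-zero n (λ j → off (suc j) λ ()))) (ℤ.+-identityʳ _)
sum-single (suc n) h (suc i) off =
  trans (cong₂ _+_ (off zero λ ()) (sum-single n (h ∘ suc) i (λ j j≢i → off (suc j) (j≢i ∘ suc-injective))))
        (ℤ.+-identityˡ _)

sum-pair : ∀ n (h : Fin n → ℤ) i j → i ≢ j → (∀ k → k ≢ i → k ≢ j → h k ≡ 0ℤ) →
           sumℤ n h ≡ h i + h j
sum-pair (suc n) h zero    zero    i≢j off = ⊥-elim (i≢j refl)
sum-pair (suc n) h zero    (suc j) i≢j off =
  cong (_+_ (h zero)) (sum-single n (h ∘ suc) j (λ k k≢j → off (suc k) (λ ()) (k≢j ∘ suc-injective)))
sum-pair (suc n) h (suc i) zero    i≢j off =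
  trans (cong (_+_ (h zero)) (sum-single n (h ∘ suc) i (λ k k≢i → off (suc k) (k≢i ∘ suc-injective) (λ ()))))
        (ℤ.+-comm (h zero) _)
sum-pair (suc n) h (suc i) (suc j) i≢j off =
  trans (cong₂ _+_ (off zero (λ ()) (λ ()))
                   (sum-pair n (h ∘ suc) i j (i≢j ∘ cong suc)
                      (λ k k≢i k≢j → off (suc k) (k≢i ∘ suc-injective) (k≢j ∘ suc-injective))))
        (ℤ.+-identityˡ _)

sum-if : ∀ n v x (g : Fin n → ℤ) → sumℤ n (λ w → (if ⌊ v ≟ w ⌋ then x else 0ℤ) * g w) ≡ x * g v
sum-if n v x g = trans
  (sum-single n (λ w → (if ⌊ v ≟ w ⌋ then x else 0ℤ) * g w) v
     (λ w w≢v → cong (_* g w) (if-no (v ≟ w) (w≢v ∘ sym))))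
  (cong (_* g v) (if-yes (v ≟ v) refl))

sum-splitAt : ∀ p q (h : Fin (p ℕ.+ q) → ℤ) →
              sumℤ (p ℕ.+ q) h ≡ sumℤ p (λ i → h (i ↑ˡ q)) + sumℤ q (λ j → h (p ↑ʳ j))
sum-splitAt zero    q h = sym (ℤ.+-identityˡ _)
sum-splitAt (suc p) q h = trans (cong (_+_ (h zero)) (sum-splitAt p q (h ∘ suc)))
                                (sym (ℤ.+-assoc (h zero) _ _))

sum-telescope : ∀ n (g : Fin (suc n) → ℤ) →
                sumℤ n (λ i → g (suc i) - g (inject₁ i)) ≡ g (fromℕ n) - g zero
sum-telescope zero    g = sym (ℤ.+-inverseʳ (g zero))
sum-telescope (suc n) g = trans (cong (_+_ (g (suc zero) - g zero)) (sum-telescope n (g ∘ suc)))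
                                (cancel (g zero) (g (suc zero)) (g (fromℕ (suc n))))
  where
  cancel : ∀ a b c → (b - a) + (c - b) ≡ c - a
  cancel = solve-∀

sum-cyclic : (h : Fin 4 → ℤ) → sumℤ 4 (λ a → h (next a)) ≡ sumℤ 4 h
sum-cyclic h = rotate (h zero) (h (suc zero)) (h (suc (suc zero))) (h (suc (suc (suc zero))))
  where
  rotate : ∀ a b c d → b + (c + (d + (a + 0ℤ))) ≡ a + (b + (c + (d + 0ℤ)))
  rotate = solve-∀

sum-upper : ∀ n k {h : Fin n → ℤ} → (∀ i → h i ≤ + k) → sumℤ n h ≤ + (n ℕ.* k)
sum-upper zero    k h≤k = ℤ.≤-refl
sum-upper (suc n) k h≤k = ℤ.+-mono-≤ (h≤k zero) (sum-upper n k (h≤k ∘ suc))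

sum-nonNeg : ∀ n {h : Fin n → ℤ} → (∀ i → 0ℤ ≤ h i) → 0ℤ ≤ sumℤ n h
sum-nonNeg zero    0≤h = ℤ.≤-refl
sum-nonNeg (suc n) 0≤h = ℤ.+-mono-≤ (0≤h zero) (sum-nonNeg n (0≤h ∘ suc))

-- Serves twice: for the sum of squares of a chain orthogonal to itself, and for the number of
-- dominoes lying across a barrier.
sum-nonNeg-≤0⇒0 : ∀ n {h : Fin n → ℤ} → (∀ i → 0ℤ ≤ h i) → sumℤ n h ≤ 0ℤ → ∀ i → h i ≡ 0ℤ
sum-nonNeg-≤0⇒0 (suc n) {h} 0≤h s≤0 zero = ℤ.≤-antisym
  (ℤ.≤-trans (subst (_≤ h zero + sumℤ n (h ∘ suc)) (ℤ.+-identityʳ _)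
                (ℤ.+-monoʳ-≤ (h zero) (sum-nonNeg n (0≤h ∘ suc)))) s≤0)
  (0≤h zero)
sum-nonNeg-≤0⇒0 (suc n) {h} 0≤h s≤0 (suc i) = sum-nonNeg-≤0⇒0 n (0≤h ∘ suc)
  (ℤ.≤-trans (subst (_≤ h zero + sumℤ n (h ∘ suc)) (ℤ.+-identityˡ _)
                (ℤ.+-monoˡ-≤ (sumℤ n (h ∘ suc)) (0≤h zero))) s≤0) i

-- Linear algebra over the integers.

0≤square : ∀ i → 0ℤ ≤ i * i
0≤square (+ n)      = subst (0ℤ ≤_) (ℤ.pos-* n n) (ℤ.+≤+ ℕ.z≤n)
0≤square (ℤ.-[1+ n ]) = ℤ.+≤+ ℕ.z≤n

square≡0⇒≡0 : ∀ i → i * i ≡ 0ℤ → i ≡ 0ℤ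
square≡0⇒≡0 i eq = [ (λ p → p) , (λ p → p) ]′ (ℤ.i*j≡0⇒i≡0∨j≡0 i eq)

*-cancelˡ-≢0 : ∀ b {x y} → b ≢ 0ℤ → b * x ≡ b * y → x ≡ y
*-cancelˡ-≢0 b {x} {y} b≢0 eq = ℤ.*-cancelˡ-≡ b x y {{ℤ.≢-nonZero b≢0}} eq

-- Fraction-free elimination of the first unknown.
nontrivial-kernel : ∀ n k → k ≡ suc n → (M : Fin n → Fin k → ℤ) →
  Σ (Fin k → ℤ) λ x → (∃ λ j → x j ≢ 0ℤ) × (∀ i → sumℤ k (λ j → M i j * x j) ≡ 0ℤ)
nontrivial-kernel zero    _ refl M = (λ _ → 1ℤ) , (zero , λ ()) , λ ()
nontrivial-kernel (suc n) _ refl M with any? (λ i → ¬? (M i zero ℤ.≟ 0ℤ))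
... | no ¬pivot = unit , (zero , λ ()) , kernel
  where
  unit : Fin (suc (suc n)) → ℤ
  unit zero    = 1ℤ
  unit (suc _) = 0ℤ
  kernel : ∀ i → sumℤ (suc (suc n)) (λ j → M i j * unit j) ≡ 0ℤ
  kernel i = cong₂ _+_
    (trans (ℤ.*-identityʳ _) (decidable-stable (M i zero ℤ.≟ 0ℤ) (λ ne → ¬pivot (i , ne))))
    (sum-zero (suc n) (λ j → ℤ.*-zeroʳ (M i (suc j))))
... | yes (p , a≢0) = x , (suc j₀ , x≢0) , kernel
  where
  a = M p zero
  reduced : Fin n → Fin (suc n) → ℤ
  reduced i j = a * M (punchIn p i) (suc j) - M (punchIn p i) zero * M p (suc j)
  ih = nontrivial-kernel n (suc n) refl reduced
  y = proj₁ ih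
  j₀ = proj₁ (proj₁ (proj₂ ih))
  dot : Fin (suc n) → ℤ
  dot i = sumℤ (suc n) (λ j → M i (suc j) * y j)
  x : Fin (suc (suc n)) → ℤ
  -- The pivot row `p` is solved for the first unknown. Scaling all the others by the pivot `a`
  -- takes the place of dividing by it.
  x zero    = - dot p
  x (suc j) = a * y j
  x≢0 : a * y j₀ ≢ 0ℤ
  x≢0 eq = [ a≢0 , proj₂ (proj₁ (proj₂ ih)) ]′ (ℤ.i*j≡0⇒i≡0∨j≡0 a eq)
  row : ∀ i → sumℤ (suc (suc n)) (λ j → M i j * x j) ≡ M i zero * - dot p + a * dot i
  row i = cong (_+_ (M i zero * - dot p)) (trans
    (sum-cong (suc n) (λ j → pull (M i (suc j)) a (y j)))
    (sum-*ˡ (suc n) a (λ j → M i (suc j) * y j)))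
    where
    pull : ∀ m a y → m * (a * y) ≡ a * (m * y)
    pull = solve-∀
  pivot-row : ∀ a d → a * - d + a * d ≡ 0ℤ
  pivot-row = solve-∀
  reduced-row : ∀ i → M (punchIn p i) zero * - dot p + a * dot (punchIn p i) ≡ 0ℤ
  reduced-row i = begin
    m * - dot p + a * dot q   ≡⟨ regroup m (dot p) a (dot q) ⟩
    a * dot q - m * dot p     ≡⟨ cong₂ _-_ (sum-*ˡ (suc n) a (λ j → M q (suc j) * y j))
                                             (sum-*ˡ (suc n) m (λ j → M p (suc j) * y j)) ⟨
    sumℤ (suc n) (λ j → a * (M q (suc j) * y j)) - sumℤ (suc n) (λ j → m * (M p (suc j) * y j))
      ≡⟨ sum-minus (suc n) (λ j → a * (M q (suc j) * y j)) (λ j → m * (M p (suc j) * y j)) ⟨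
    sumℤ (suc n) (λ j → a * (M q (suc j) * y j) - m * (M p (suc j) * y j))
      ≡⟨ sum-cong (suc n) (λ j → factor a (M q (suc j)) m (M p (suc j)) (y j)) ⟩
    sumℤ (suc n) (λ j → reduced i j * y j) ≡⟨ proj₂ (proj₂ ih) i ⟩
    0ℤ ∎
    where
    q = punchIn p i
    m = M q zero
    regroup : ∀ m d a e → m * - d + a * e ≡ a * e - m * d
    regroup = solve-∀
    factor : ∀ a u m w y → a * (u * y) - m * (w * y) ≡ (a * u - m * w) * y
    factor = solve-∀
  kernel : ∀ i → sumℤ (suc (suc n)) (λ j → M i j * x j) ≡ 0ℤ
  kernel i with p ≟ i
  ... | yes refl = trans (row p) (pivot-row a (dot p))
  ... | no p≢i   = trans (row i)
    (subst (λ r → M r zero * - dot p + a * dot r ≡ 0ℤ) (punchIn-punchOut p≢i) (reduced-row (punchOut p≢i)))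

-- Counting with Boolean indicators.

unique-one : ∀ n (k : Fin n → ℕ) → (∀ i → k i ≡ 0 ⊎ k i ≡ 1) → sumℕ n k ≡ 1 →
             ∃ λ i → k i ≡ 1 × (∀ j → j ≢ i → k j ≡ 0)
unique-one (suc n) k bit eq with k zero in k₀ | bit zero
... | 1 | _ = zero , k₀ , off
  where
  vanish : ∀ m (h : Fin m → ℕ) → sumℕ m h ≡ 0 → ∀ i → h i ≡ 0
  vanish (suc m) h s zero    = ℕ.m+n≡0⇒m≡0 (h zero) s
  vanish (suc m) h s (suc i) = vanish m (h ∘ suc) (ℕ.m+n≡0⇒n≡0 (h zero) s) i
  off : ∀ j → j ≢ zero → k j ≡ 0
  off zero    j≢0 = ⊥-elim (j≢0 refl)
  off (suc j) _   = vanish n (k ∘ suc) (ℕ.suc-injective eq) j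
... | 0 | _ with unique-one n (k ∘ suc) (bit ∘ suc) eq
... | i , ki , off = suc i , ki , λ { zero _ → k₀ ; (suc j) ne → off j (ne ∘ cong suc) }
unique-one (suc n) k bit eq | suc (suc _) | inj₁ ()
unique-one (suc n) k bit eq | suc (suc _) | inj₂ ()

unique-pair : ∀ n (k : Fin n → ℕ) → (∀ i → k i ≡ 0 ⊎ k i ≡ 1) → sumℕ n k ≡ 2 →
              ∃ λ i → ∃ λ j → i ≢ j × k i ≡ 1 × k j ≡ 1 × (∀ l → l ≢ i → l ≢ j → k l ≡ 0)
unique-pair (suc n) k bit eq with k zero in k₀ | bit zero
... | 1 | _ with unique-one n (k ∘ suc) (bit ∘ suc) (ℕ.suc-injective eq)
... | j , kj , off = zero , suc j , (λ ()) , k₀ , kj ,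
  λ { zero ne _ → ⊥-elim (ne refl) ; (suc l) _ ne → off l (ne ∘ cong suc) }
unique-pair (suc n) k bit eq | 0 | _ with unique-pair n (k ∘ suc) (bit ∘ suc) eq
... | i , j , i≢j , ki , kj , off = suc i , suc j , i≢j ∘ suc-injective , ki , kj ,
  λ { zero _ _ → k₀ ; (suc l) ne ne' → off l (ne ∘ cong suc) (ne' ∘ cong suc) }
unique-pair (suc n) k bit eq | suc (suc _) | inj₁ ()
unique-pair (suc n) k bit eq | suc (suc _) | inj₂ ()

-- Passage from natural counts to integer sums, where differences can be taken and summations
-- exchanged.
count-⟦⟧ : ∀ n (p : Fin n → Bool) → + count n p ≡ sumℤ n (λ i → ⟦ p i ⟧)
count-⟦⟧ zero    p = refl
count-⟦⟧ (suc n) p with p zero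
... | true  = cong (_+_ 1ℤ) (count-⟦⟧ n (p ∘ suc))
... | false = trans (count-⟦⟧ n (p ∘ suc)) (sym (ℤ.+-identityˡ _))

split-cases : ∀ p q (i : Fin (p ℕ.+ q)) → (∃ λ j → i ≡ j ↑ˡ q) ⊎ (∃ λ j → i ≡ p ↑ʳ j)
split-cases p q i with splitAt p i in eq
... | inj₁ j = inj₁ (j , sym (splitAt⁻¹-↑ˡ eq))
... | inj₂ j = inj₂ (j , sym (splitAt⁻¹-↑ʳ eq))

count≡1⇒others : ∀ n (p : Fin n → Bool) → count n p ≡ 1 → ∀ {i j} → p i ≡ true → j ≢ i → p j ≡ false
count≡1⇒others n p eq {i} {j} pi j≢i with unique-one n (λ i → if p i then 1 else 0) bit eq
  where
  bit : ∀ i → (if p i then 1 else 0) ≡ 0 ⊎ (if p i then 1 else 0) ≡ 1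
  bit i with p i
  ... | true  = inj₂ refl
  ... | false = inj₁ refl
... | k , _ , off with i ≟ k | p j in pj
... | yes refl | false = refl
... | yes refl | true  = ⊥-elim (ℕ.1+n≢0 (trans (cong (λ b → if b then 1 else 0) (sym pj)) (off j j≢i)))
... | no i≢k   | _     = ⊥-elim (ℕ.1+n≢0 (trans (cong (λ b → if b then 1 else 0) (sym pi)) (off i i≢k)))

⌊⌋-witness : ∀ {p} {P : Set p} (d : Dec P) → ⌊ d ⌋ ≡ true → P
⌊⌋-witness (yes p) _ = p

count≤ : ∀ n p → count n p ℕ.≤ n
count≤ zero    p = ℕ.z≤n
count≤ (suc n) p with p zero
... | true  = ℕ.s≤s (count≤ n (p ∘ suc))
... | false = ℕ.m≤n⇒m≤1+n (count≤ n (p ∘ suc))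

insert : ∀ {n} → Fin n → (Fin n → Bool) → Fin n → Bool
insert v p w = ⌊ v ≟ w ⌋ ∨ p w

insert-self : ∀ {n} v (p : Fin n → Bool) → insert v p v ≡ true
insert-self v p = cong (_∨ p v) (⌊⌋≡true (v ≟ v) refl)

insert-⊇ : ∀ {n} v (p : Fin n → Bool) {w} → p w ≡ true → insert v p w ≡ true
insert-⊇ v p {w} pw = trans (cong (⌊ v ≟ w ⌋ ∨_) pw) (∨-zeroʳ ⌊ v ≟ w ⌋)

insert-⁻ : ∀ {n} v (p : Fin n → Bool) {w} → insert v p w ≡ true → v ≡ w ⊎ p w ≡ true
insert-⁻ v p {w} i with v ≟ w
... | yes eq = inj₁ eq
... | no _   = inj₂ i

-- This growth is the measure that makes the search `explore` terminate.
count-insert : ∀ n v (p : Fin n → Bool) → p v ≡ false → count n (insert v p) ≡ suc (count n p)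
count-insert n v p pv = ℤ.+-injective (begin
  + count n (insert v p)                        ≡⟨ count-⟦⟧ n (insert v p) ⟩
  sumℤ n (λ w → ⟦ insert v p w ⟧)               ≡⟨ sum-cong n pointwise ⟩
  sumℤ n (λ w → ⟦ ⌊ v ≟ w ⌋ ⟧ * 1ℤ + ⟦ p w ⟧)   ≡⟨ sum-+ n (λ w → ⟦ ⌊ v ≟ w ⌋ ⟧ * 1ℤ) (λ w → ⟦ p w ⟧) ⟩
  sumℤ n (λ w → ⟦ ⌊ v ≟ w ⌋ ⟧ * 1ℤ) + sumℤ n (λ w → ⟦ p w ⟧)
    ≡⟨ cong₂ _+_ (sum-if n v 1ℤ (λ _ → 1ℤ)) (sym (count-⟦⟧ n p)) ⟩
  + suc (count n p) ∎)
  where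
  pointwise : ∀ w → ⟦ insert v p w ⟧ ≡ ⟦ ⌊ v ≟ w ⌋ ⟧ * 1ℤ + ⟦ p w ⟧
  pointwise w with v ≟ w
  ... | yes refl = cong (λ b → 1ℤ + ⟦ b ⟧) (sym pv)
  ... | no _     = sym (ℤ.+-identityˡ ⟦ p w ⟧)

-- Cyclic order in a square, and incidence of squares with edges.

next≢ : ∀ a → next a ≢ a
next≢ zero ()
next≢ (suc zero) ()
next≢ (suc (suc zero)) ()
next≢ (suc (suc (suc zero))) ()

next-next≢ : ∀ a → next (next a) ≢ a
next-next≢ zero ()
next-next≢ (suc zero) ()
next-next≢ (suc (suc zero)) ()
next-next≢ (suc (suc (suc zero))) ()

next³≢ : ∀ a → next (next (next a)) ≢ a
next³≢ zero ()
next³≢ (suc zero) ()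
next³≢ (suc (suc zero)) ()
next³≢ (suc (suc (suc zero))) ()

next⁴ : ∀ a → next (next (next (next a))) ≡ a
next⁴ zero = refl
next⁴ (suc zero) = refl
next⁴ (suc (suc zero)) = refl
next⁴ (suc (suc (suc zero))) = refl

module Annulus (A : QuadComplex) (ann : IsQuadAnnulus A) where
  open QuadComplex A
  open IsQuadAnnulus ann

  forward : Fin nF → Fin 4 → Bool
  forward f a = ⌊ corner f a ≟ src (side f a) ⌋

  orientation : ∀ f a →
    (src (side f a) ≡ corner f a × tgt (side f a) ≡ corner f (next a) × forward f a ≡ true) ⊎
    (src (side f a) ≡ corner f (next a) × tgt (side f a) ≡ corner f a × forward f a ≡ false)
  orientation f a with side-joins f a
  ... | inj₁ (s , t) = inj₁ (s , t , ⌊⌋≡true _ (sym s))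
  ... | inj₂ (s , t) = inj₂ (s , t , ⌊⌋≡false _ (λ eq → next≢ a (corners-distinct f _ _ (sym (trans eq s)))))

  -- Compare endpoints. Sides traversed in the same direction share a corner in the same role; sides
  -- traversed in opposite directions would give `next a ≡ b` and `next b ≡ a`, hence
  -- `next (next a) ≡ a`.
  side-injective : ∀ f a b → side f a ≡ side f b → a ≡ b
  side-injective f a b eq with side-joins f a | side-joins f b
  ... | inj₁ (s , _) | inj₁ (s' , _) = corners-distinct f a b (trans (sym s) (trans (cong src eq) s'))
  ... | inj₂ (_ , t) | inj₂ (_ , t') = corners-distinct f a b (trans (sym t) (trans (cong tgt eq) t'))
  ... | inj₁ (s , t) | inj₂ (s' , t') = ⊥-elim (next-next≢ a (trans
    (cong next (corners-distinct f _ _ (trans (sym t) (trans (cong tgt eq) t'))))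
    (sym (corners-distinct f _ _ (trans (sym s) (trans (cong src eq) s'))))))
  ... | inj₂ (s , t) | inj₁ (s' , t') = ⊥-elim (next-next≢ a (trans
    (cong next (corners-distinct f _ _ (trans (sym s) (trans (cong src eq) s'))))
    (sym (corners-distinct f _ _ (trans (sym t) (trans (cong tgt eq) t'))))))

  -- If both squares ran along the edge in the same direction, `oriented` would identify two
  -- consecutive corners of `g`.
  forward-opposite : ∀ f a g b → side f a ≡ side g b → f ≢ g → forward g b ≡ not (forward f a)
  forward-opposite f a g b eq f≢g with orientation f a | orientation g b
  ... | inj₁ (_ , _ , p) | inj₂ (_ , _ , q) = trans q (cong not (sym p))
  ... | inj₂ (_ , _ , p) | inj₁ (_ , _ , q) = trans q (cong not (sym p))
  ... | inj₁ (s , _ , _) | inj₁ (s' , _ , _) = ⊥-elim (next≢ b (corners-distinct g _ _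
    (trans (sym (oriented f a g b eq f≢g)) (trans (sym s) (trans (cong src eq) s')))))
  ... | inj₂ (_ , t , _) | inj₂ (_ , t' , _) = ⊥-elim (next≢ b (corners-distinct g _ _
    (trans (sym (oriented f a g b eq f≢g)) (trans (sym t) (trans (cong tgt eq) t')))))

  -- The cellular incidence number of a square and one of its sides.
  orient : Fin nF → Fin 4 → ℤ
  orient f a = sign (forward f a)

  sidesIn : Fin nE → Fin nF → ℕ
  sidesIn e f = count 4 (λ a → ⌊ side f a ≟ e ⌋)

  squareSum : Fin nE → (Fin nF → Fin 4 → ℤ) → Fin nF → ℤ
  squareSum e h f = sumℤ 4 (λ a → if ⌊ side f a ≟ e ⌋ then h f a else 0ℤ)

  -- Common form of the boundary operator and of the flux across a selected edge;
  -- `boundary-incidence` and `interior-incidence` reduce it to one or two terms.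
  incidenceSum : Fin nE → (Fin nF → Fin 4 → ℤ) → ℤ
  incidenceSum e h = sumℤ nF (squareSum e h)

  squareSum-side : ∀ f a h → squareSum (side f a) h f ≡ h f a
  squareSum-side f a h = trans
    (sum-single 4 (λ b → if ⌊ side f b ≟ side f a ⌋ then h f b else 0ℤ) a
       (λ b b≢a → if-no (side f b ≟ side f a) (b≢a ∘ side-injective f b a)))
    (if-yes (side f a ≟ side f a) refl)

  squareSum-none : ∀ e f h → (∀ a → side f a ≢ e) → squareSum e h f ≡ 0ℤ
  squareSum-none e f h none = sum-zero 4 (λ a → if-no {x = h f a} (side f a ≟ e) (none a))

  sidesIn-side : ∀ f a → sidesIn (side f a) f ≡ 1
  sidesIn-side f a = ℤ.+-injective (trans (count-⟦⟧ 4 (λ b → ⌊ side f b ≟ side f a ⌋)) (squareSum-side f a (λ _ _ → 1ℤ)))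

  sidesIn-none : ∀ e f → (∀ a → side f a ≢ e) → sidesIn e f ≡ 0
  sidesIn-none e f none = ℤ.+-injective (trans (count-⟦⟧ 4 (λ a → ⌊ side f a ≟ e ⌋)) (squareSum-none e f (λ _ _ → 1ℤ) none))

  hasSide : ∀ e f → Dec (∃ λ a → side f a ≡ e)
  hasSide e f = any? (λ a → side f a ≟ e)

  sidesIn-0∨1 : ∀ e f → sidesIn e f ≡ 0 ⊎ sidesIn e f ≡ 1
  sidesIn-0∨1 e f with hasSide e f
  ... | yes (a , refl) = inj₂ (sidesIn-side f a)
  ... | no none        = inj₁ (sidesIn-none e f (λ a eq → none (a , eq)))

  sidesIn≡1 : ∀ e f → sidesIn e f ≡ 1 → ∃ λ a → side f a ≡ e
  sidesIn≡1 e f k≡1 with hasSide e f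
  ... | yes p   = p
  ... | no none = ⊥-elim (ℕ.1+n≢0 (trans (sym k≡1) (sidesIn-none e f (λ a eq → none (a , eq)))))

  sidesIn≡0 : ∀ e f → sidesIn e f ≡ 0 → ∀ a → side f a ≢ e
  sidesIn≡0 e f k≡0 a refl = ℕ.1+n≢0 (trans (sym (sidesIn-side f a)) k≡0)

  -- `sideCount` is a sum over squares of the numbers `sidesIn`, each 0 or 1. Total 1 singles out
  -- one square; total 2, in `interior-incidence`, singles out two.
  boundary-incidence : ∀ {e} → BoundaryEdge A e → ∃ λ f → ∃ λ a → side f a ≡ e ×
    (∀ g b → side g b ≡ e → g ≡ f) × (∀ h → incidenceSum e h ≡ h f a)
  boundary-incidence {e} be with unique-one nF (sidesIn e) (sidesIn-0∨1 e) be
  ... | f , kf , off with sidesIn≡1 e f kf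
  ... | a , refl = f , a , refl ,
    (λ g b eq → decidable-stable (g ≟ f) (λ g≢f → sidesIn≡0 e g (off g g≢f) b eq)) ,
    (λ h → trans (sum-single nF (squareSum e h) f (λ g g≢f → squareSum-none e g h (sidesIn≡0 e g (off g g≢f))))
                 (squareSum-side f a h))

  interior-incidence : ∀ {e} → InteriorEdge A e →
    ∃ λ f → ∃ λ a → ∃ λ g → ∃ λ b → f ≢ g × side f a ≡ e × side g b ≡ e ×
    (∀ f' a' → side f' a' ≡ e → f' ≡ f ⊎ f' ≡ g) × (∀ h → incidenceSum e h ≡ h f a + h g b)
  interior-incidence {e} ie with unique-pair nF (sidesIn e) (sidesIn-0∨1 e) ie
  ... | f , g , f≢g , kf , kg , off with sidesIn≡1 e f kf | sidesIn≡1 e g kg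
  ... | a , p | b , q = f , a , g , b , f≢g , p , q , only , total
    where
    only : ∀ f' a' → side f' a' ≡ e → f' ≡ f ⊎ f' ≡ g
    only f' a' eq with f' ≟ f | f' ≟ g
    ... | yes r | _     = inj₁ r
    ... | no _  | yes r = inj₂ r
    ... | no r  | no r' = ⊥-elim (sidesIn≡0 e f' (off f' r r') a' eq)
    at : ∀ f a → side f a ≡ e → ∀ h → squareSum e h f ≡ h f a
    at f a refl = squareSum-side f a
    total : ∀ h → incidenceSum e h ≡ h f a + h g b
    total h = trans
      (sum-pair nF (squareSum e h) f g f≢g (λ l l≢f l≢g → squareSum-none e l h (sidesIn≡0 e l (off l l≢f l≢g))))
      (cong₂ _+_ (at f a p h) (at g b q h))

  incident : ∀ e → ∃ λ f → ∃ λ a → side f a ≡ e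
  incident e with edge-sides e
  ... | inj₁ be = let f , a , p , _ = boundary-incidence be in f , a , p
  ... | inj₂ ie = let f , a , _ , _ , _ , p , _ = interior-incidence ie in f , a , p

  -- Cellular chains and cochains, and potentials of cocycles vanishing on the boundary.

  δ : (Fin nV → ℤ) → Fin nE → ℤ
  δ g e = g (tgt e) - g (src e)

  -- The cellular boundary of the 2-chain `c`, evaluated at `e`.
  ∂ : (Fin nF → ℤ) → Fin nE → ℤ
  ∂ c e = incidenceSum e (λ f a → orient f a * c f)

  Closed : (Fin nE → ℤ) → Set
  Closed q = ∀ f → sumℤ 4 (λ a → orient f a * q (side f a)) ≡ 0ℤ

  orient-δ : ∀ g f a → orient f a * δ g (side f a) ≡ g (corner f (next a)) - g (corner f a)
  orient-δ g f a with orientation f a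
  ... | inj₁ (s , t , p) rewrite s | t | p = ℤ.*-identityˡ _
  ... | inj₂ (s , t , p) rewrite s | t | p = flip (g (corner f a)) (g (corner f (next a)))
    where
    flip : ∀ x y → -1ℤ * (x - y) ≡ y - x
    flip = solve-∀

  δ-closed : ∀ g → Closed (δ g)
  δ-closed g f = begin
    sumℤ 4 (λ a → orient f a * δ g (side f a))                       ≡⟨ sum-cong 4 (orient-δ g f) ⟩
    sumℤ 4 (λ a → g (corner f (next a)) - g (corner f a))            ≡⟨ sum-minus 4 (gc ∘ next) gc ⟩
    sumℤ 4 (gc ∘ next) - sumℤ 4 gc                                   ≡⟨ ℤ.i≡j⇒i-j≡0 (sum-cyclic gc) ⟩
    0ℤ ∎
    where
    gc : Fin 4 → ℤ
    gc a = g (corner f a)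

  -- Discrete Stokes theorem: after the summations are exchanged, the square `f` contributes `c f`
  -- times the circulation of `q` around it.
  ∂-orthogonal : ∀ c {q} → Closed q → sumℤ nE (λ e → ∂ c e * q e) ≡ 0ℤ
  ∂-orthogonal c {q} closed = begin
    sumℤ nE (λ e → ∂ c e * q e)
      ≡⟨ sum-cong nE (λ e → trans (sym (sum-*ʳ nF (q e) (λ f → sumℤ 4 (term e f))))
           (sum-cong nF (λ f → sym (sum-*ʳ 4 (q e) (term e f))))) ⟩
    sumℤ nE (λ e → sumℤ nF (λ f → sumℤ 4 (λ a → term e f a * q e)))
      ≡⟨ sum-swap nE nF (λ e f → sumℤ 4 (λ a → term e f a * q e)) ⟩
    sumℤ nF (λ f → sumℤ nE (λ e → sumℤ 4 (λ a → term e f a * q e)))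
      ≡⟨ sum-zero nF square ⟩
    0ℤ ∎
    where
    term : Fin nE → Fin nF → Fin 4 → ℤ
    term e f a = if ⌊ side f a ≟ e ⌋ then orient f a * c f else 0ℤ
    pull : ∀ o c q → o * c * q ≡ c * (o * q)
    pull = solve-∀
    square : ∀ f → sumℤ nE (λ e → sumℤ 4 (λ a → term e f a * q e)) ≡ 0ℤ
    square f = begin
      sumℤ nE (λ e → sumℤ 4 (λ a → term e f a * q e))
        ≡⟨ sum-swap nE 4 (λ e a → term e f a * q e) ⟩
      sumℤ 4 (λ a → sumℤ nE (λ e → term e f a * q e))
        ≡⟨ sum-cong 4 (λ a → trans (sum-if nE (side f a) (orient f a * c f) q)
                                   (pull (orient f a) (c f) (q (side f a)))) ⟩
      sumℤ 4 (λ a → c f * (orient f a * q (side f a)))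
        ≡⟨ sum-*ˡ 4 (c f) (λ a → orient f a * q (side f a)) ⟩
      c f * sumℤ 4 (λ a → orient f a * q (side f a))
        ≡⟨ cong (c f *_) (closed f) ⟩
      c f * 0ℤ ≡⟨ ℤ.*-zeroʳ (c f) ⟩
      0ℤ ∎

  orient-opposite : ∀ f a g b → side f a ≡ side g b → f ≢ g → orient g b ≡ - orient f a
  orient-opposite f a g b eq f≢g = trans (cong sign (forward-opposite f a g b eq f≢g)) (sign-not (forward f a))
    where
    sign-not : ∀ b → sign (not b) ≡ - sign b
    sign-not true  = refl
    sign-not false = refl

  -- The boundary of the sum of all squares lives on the two boundary circles; the label keeps the
  -- outer one. This is the 1-cycle around the hole.
  outerCycle : Fin nE → ℤ
  outerCycle e = ∂ (λ _ → 1ℤ) e * ⟦ outer (src e) ⟧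

  ∂1-interior : ∀ {e} → InteriorEdge A e → ∂ (λ _ → 1ℤ) e ≡ 0ℤ
  ∂1-interior ie with interior-incidence ie
  ... | f , a , g , b , f≢g , refl , q , _ , total = begin
    ∂ (λ _ → 1ℤ) (side f a)             ≡⟨ total (λ f a → orient f a * 1ℤ) ⟩
    orient f a * 1ℤ + orient g b * 1ℤ   ≡⟨ cong (λ o → orient f a * 1ℤ + o * 1ℤ) (orient-opposite f a g b (sym q) f≢g) ⟩
    orient f a * 1ℤ + - orient f a * 1ℤ ≡⟨ cancel (orient f a) ⟩
    0ℤ ∎
    where
    cancel : ∀ o → o * 1ℤ + - o * 1ℤ ≡ 0ℤ
    cancel = solve-∀

  outer-label : ∀ {e} → BoundaryEdge A e → outer (src e) ≡ outer (tgt e)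
  outer-label {e} be = boundary-labels (src e) (tgt e) (e , be , inj₁ (refl , refl))

  -- The two ends of a boundary edge carry the same label, so the label can be moved onto `g`. What
  -- remains is a boundary paired with the coboundary of `gₒ`.
  outerCycle-δ : ∀ g → sumℤ nE (λ e → outerCycle e * δ g e) ≡ 0ℤ
  outerCycle-δ g = trans (sum-cong nE restrict) (∂-orthogonal (λ _ → 1ℤ) (δ-closed gₒ))
    where
    gₒ : Fin nV → ℤ
    gₒ v = ⟦ outer v ⟧ * g v
    boundary : ∀ b o t s → b * o * (t - s) ≡ b * (o * t - o * s)
    boundary = solve-∀
    restrict : ∀ e → outerCycle e * δ g e ≡ ∂ (λ _ → 1ℤ) e * δ gₒ e
    restrict e with edge-sides e
    ... | inj₂ ie rewrite ∂1-interior ie = refl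
    ... | inj₁ be = trans
      (boundary (∂ (λ _ → 1ℤ) e) ⟦ outer (src e) ⟧ (g (tgt e)) (g (src e)))
      (cong (λ o → ∂ (λ _ → 1ℤ) e * (⟦ o ⟧ * g (tgt e) - gₒ (src e))) (outer-label be))

  VanishesOnBoundary : (Fin nE → ℤ) → Set
  VanishesOnBoundary q = ∀ e → BoundaryEdge A e → q e ≡ 0ℤ

  -- The supports are disjoint, since `outerCycle` is zero on interior edges.
  outerCycle-orthogonal : ∀ {q} → VanishesOnBoundary q → sumℤ nE (λ e → outerCycle e * q e) ≡ 0ℤ
  outerCycle-orthogonal {q} vanish = sum-zero nE term
    where
    term : ∀ e → outerCycle e * q e ≡ 0ℤ
    term e with edge-sides e
    ... | inj₁ be = trans (cong (outerCycle e *_) (vanish e be)) (ℤ.*-zeroʳ (outerCycle e))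
    ... | inj₂ ie rewrite ∂1-interior ie = refl

  orient≢0 : ∀ f a → orient f a ≢ 0ℤ
  orient≢0 f a with forward f a
  ... | true  = λ ()
  ... | false = λ ()

  boundary-edge-of : ∀ {v} → BoundaryVertex A v → ∃ λ e → BoundaryEdge A e × outer (src e) ≡ outer v
  boundary-edge-of (e , be , inj₁ refl) = e , be , refl
  boundary-edge-of (e , be , inj₂ refl) = e , be , outer-label be

  ∂-boundary : ∀ {e} → BoundaryEdge A e → ∃ λ f → ∃ λ a → ∀ c → ∂ c e ≡ orient f a * c f
  ∂-boundary be = let f , a , _ , _ , total = boundary-incidence be
                  in f , a , λ c → total (λ f a → orient f a * c f)

  -- On interior edges only `∂ c` remains, so `c` agrees on neighbouring squares and is constant by
  -- connectedness. An inner boundary edge, where `outerCycle` is zero, makes the constant 0; an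
  -- outer boundary edge then makes `m` zero.
  ∂-outerCycle-independent : ∀ c m → (∀ e → ∂ c e + outerCycle e * m ≡ 0ℤ) →
                             (∀ f → c f ≡ 0ℤ) × m ≡ 0ℤ
  ∂-outerCycle-independent c m rel = c≡0 , m≡0
    where
    cancel : ∀ o x y → o * x + - o * y ≡ o * (x - y)
    cancel = solve-∀
    vanishes : ∀ f a x → orient f a * x ≡ 0ℤ → x ≡ 0ℤ
    vanishes f a x eq = [ ⊥-elim ∘ orient≢0 f a , (λ p → p) ]′ (ℤ.i*j≡0⇒i≡0∨j≡0 (orient f a) eq)
    ∂-interior : ∀ {e} → InteriorEdge A e → ∂ c e ≡ 0ℤ
    ∂-interior {e} ie = begin
      ∂ c e                           ≡⟨ ℤ.+-identityʳ (∂ c e) ⟨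
      ∂ c e + 0ℤ                      ≡⟨ cong (λ z → ∂ c e + z * ⟦ outer (src e) ⟧ * m) (∂1-interior ie) ⟨
      ∂ c e + outerCycle e * m        ≡⟨ rel e ⟩
      0ℤ ∎
    across : ∀ f a g b → side f a ≡ side g b → c f ≡ c g
    across f a g b eq with edge-sides (side f a)
    ... | inj₁ be = let _ , _ , _ , only , _ = boundary-incidence be
                    in cong c (trans (only f a refl) (sym (only g b (sym eq))))
    ... | inj₂ ie with interior-incidence ie
    ... | f₁ , a₁ , g₁ , b₁ , f₁≢g₁ , p , q , only , total = both (only f a refl) (only g b (sym eq))
      where
      c-eq : c f₁ ≡ c g₁
      c-eq = ℤ.i-j≡0⇒i≡j (c f₁) (c g₁) (vanishes f₁ a₁ (c f₁ - c g₁) (begin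
        orient f₁ a₁ * (c f₁ - c g₁)                   ≡⟨ cancel (orient f₁ a₁) (c f₁) (c g₁) ⟨
        orient f₁ a₁ * c f₁ + - orient f₁ a₁ * c g₁
          ≡⟨ cong (λ o → orient f₁ a₁ * c f₁ + o * c g₁) (orient-opposite f₁ a₁ g₁ b₁ (trans p (sym q)) f₁≢g₁) ⟨
        orient f₁ a₁ * c f₁ + orient g₁ b₁ * c g₁      ≡⟨ total (λ f a → orient f a * c f) ⟨
        ∂ c (side f a)                                 ≡⟨ ∂-interior ie ⟩
        0ℤ ∎))
      both : f ≡ f₁ ⊎ f ≡ g₁ → g ≡ f₁ ⊎ g ≡ g₁ → c f ≡ c g
      both (inj₁ refl) (inj₁ refl) = refl
      both (inj₁ refl) (inj₂ refl) = c-eq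
      both (inj₂ refl) (inj₁ refl) = sym c-eq
      both (inj₂ refl) (inj₂ refl) = refl
    constant : ∀ {f g} → Star (DualAdj A) f g → c f ≡ c g
    constant ε = refl
    constant {f} (_◅_ {j = h} (a , b , eq) path) = trans (across f a h b eq) (constant path)
    c≡0 : ∀ f → c f ≡ 0ℤ
    c≡0 f with inner-nonempty
    ... | v , bv , v-inner with boundary-edge-of bv
    ... | e , be , same with ∂-boundary be
    ... | f₁ , a₁ , at = trans (constant (connected f f₁)) (vanishes f₁ a₁ (c f₁) (begin
      orient f₁ a₁ * c f₁       ≡⟨ at c ⟨
      ∂ c e                     ≡⟨ ℤ.+-identityʳ (∂ c e) ⟨
      ∂ c e + 0ℤ * m            ≡⟨ cong (λ z → ∂ c e + z * m) (ℤ.*-zeroʳ (∂ (λ _ → 1ℤ) e)) ⟨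
      ∂ c e + ∂ (λ _ → 1ℤ) e * 0ℤ * m
        ≡⟨ cong (λ o → ∂ c e + ∂ (λ _ → 1ℤ) e * ⟦ o ⟧ * m) (trans same v-inner) ⟨
      ∂ c e + outerCycle e * m  ≡⟨ rel e ⟩
      0ℤ ∎))
    m≡0 : m ≡ 0ℤ
    m≡0 with outer-nonempty
    ... | v , bv , v-outer with boundary-edge-of bv
    ... | e , be , same with ∂-boundary be
    ... | f₁ , a₁ , at = vanishes f₁ a₁ m (begin
      orient f₁ a₁ * m                     ≡⟨ unit (orient f₁ a₁) m ⟩
      orient f₁ a₁ * 0ℤ + orient f₁ a₁ * 1ℤ * 1ℤ * m
        ≡⟨ cong₂ (λ x z → x + z * 1ℤ * m) (trans (at c) (cong (orient f₁ a₁ *_) (c≡0 f₁))) (at (λ _ → 1ℤ)) ⟨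
      ∂ c e + ∂ (λ _ → 1ℤ) e * 1ℤ * m
        ≡⟨ cong (λ o → ∂ c e + ∂ (λ _ → 1ℤ) e * ⟦ o ⟧ * m) (trans same v-outer) ⟨
      ∂ c e + outerCycle e * m             ≡⟨ rel e ⟩
      0ℤ ∎)
      where
      unit : ∀ o m → o * m ≡ o * 0ℤ + o * 1ℤ * 1ℤ * m
      unit = solve-∀

  -- Connectedness is available for squares, so each square is represented by its corner `zero`, and
  -- adjacent squares are compared at the source of their common edge.
  δ≡0⇒constant : ∀ g → (∀ e → δ g e ≡ 0ℤ) → ∀ v w → g v ≡ g w
  δ≡0⇒constant g δ≡0 v w with vertex-used v | vertex-used w
  ... | f , a , refl | f' , a' , refl = trans (in-square f a)
          (trans (path (connected f f')) (sym (in-square f' a')))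
    where
    step : ∀ f a → g (corner f (next a)) ≡ g (corner f a)
    step f a = ℤ.i-j≡0⇒i≡j _ _ (trans (sym (orient-δ g f a))
      (trans (cong (orient f a *_) (δ≡0 (side f a))) (ℤ.*-zeroʳ (orient f a))))
    in-square : ∀ f a → g (corner f a) ≡ g (corner f zero)
    in-square f zero                   = refl
    in-square f (suc zero)             = step f zero
    in-square f (suc (suc zero))       = trans (step f (suc zero)) (step f zero)
    in-square f (suc (suc (suc zero))) = trans (step f (suc (suc zero))) (trans (step f (suc zero)) (step f zero))
    at-src : ∀ f a → g (src (side f a)) ≡ g (corner f zero)
    at-src f a with side-joins f a
    ... | inj₁ (s , _) = trans (cong g s) (in-square f a)
    ... | inj₂ (s , _) = trans (cong g s) (in-square f (next a))
    path : ∀ {f f'} → Star (DualAdj A) f f' → g (corner f zero) ≡ g (corner f' zero)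
    path ε = refl
    path {f} (_◅_ {j = h} (a , b , eq) rest) =
      trans (trans (sym (at-src f a)) (trans (cong (g ∘ src) eq) (at-src h b))) (path rest)

  -- Since nE = nV + nF, the nE + 2 chains d, outerCycle, δ 1ᵥ, ∂ 1f satisfy a
  -- linear relation normalised by g v₀ = 0; its cycle part ∂ c + m · outerCycle is
  -- orthogonal to its cocycle part δ g + b · d, so both parts vanish.
  rational-potential : ∀ {d} → Closed d → VanishesOnBoundary d →
    Σ ℤ λ b → b ≢ 0ℤ × (Σ (Fin nV → ℤ) λ g → ∀ e → b * d e ≡ δ g e)
  -- The relation gives `δ g e + d e * b ≡ 0ℤ`, whence the minus sign in the potential.
  rational-potential {d} closed vanish = b , b≢0 , -_ ∘ g , potential
    where
    v₀ = proj₁ outer-nonempty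
    N = suc (suc (nV ℕ.+ nF))
    pairing : (Fin nE → ℤ) → (Fin nE → ℤ) → ℤ
    pairing y z = sumℤ nE (λ e → y e * z e)
    δ-entry : Fin nE → Fin nV → ℤ
    δ-entry e v = ⟦ ⌊ tgt e ≟ v ⌋ ⟧ - ⟦ ⌊ src e ≟ v ⌋ ⟧
    ∂-entry : Fin nE → Fin nF → ℤ
    ∂-entry e f = squareSum e orient f
    matrix : Fin (suc nE) → Fin N → ℤ
    matrix zero    zero          = 0ℤ
    matrix zero    (suc zero)    = 0ℤ
    matrix zero    (suc (suc j)) = [ (λ v → ⟦ ⌊ v₀ ≟ v ⌋ ⟧) , (λ _ → 0ℤ) ]′ (splitAt nV j)
    matrix (suc e) zero          = d e
    matrix (suc e) (suc zero)    = outerCycle e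
    matrix (suc e) (suc (suc j)) = [ δ-entry e , ∂-entry e ]′ (splitAt nV j)
    -- There is one equation per edge and one for the normalisation, against `nV + nF + 2` unknowns.
    -- Euler characteristic 0 leaves exactly one unknown too many.
    solution = nontrivial-kernel (suc nE) N (cong (λ k → suc (suc k)) euler-zero) matrix
    x = proj₁ solution
    b = x zero
    m = x (suc zero)
    g : Fin nV → ℤ
    g v = x (suc (suc (v ↑ˡ nF)))
    c : Fin nF → ℤ
    c f = x (suc (suc (nV ↑ʳ f)))
    split-row : ∀ (p : Fin nV → ℤ) (q : Fin nF → ℤ) →
      sumℤ (nV ℕ.+ nF) (λ j → [ p , q ]′ (splitAt nV j) * x (suc (suc j))) ≡
      sumℤ nV (λ v → p v * g v) + sumℤ nF (λ f → q f * c f)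
    split-row p q = trans (sum-splitAt nV nF (λ j → [ p , q ]′ (splitAt nV j) * x (suc (suc j)))) (cong₂ _+_
      (sum-cong nV (λ v → cong (λ s → [ p , q ]′ s * g v) (splitAt-↑ˡ nV v nF)))
      (sum-cong nF (λ f → cong (λ s → [ p , q ]′ s * c f) (splitAt-↑ʳ nV nF f))))
    g-v₀ : g v₀ ≡ 0ℤ
    g-v₀ = begin
      g v₀            ≡⟨ pad (g v₀) ⟩
      1ℤ * g v₀ + 0ℤ
        ≡⟨ cong₂ _+_ (sum-if nV v₀ 1ℤ g) (sum-zero nF {λ f → 0ℤ * c f} (λ _ → refl)) ⟨
      sumℤ nV (λ v → ⟦ ⌊ v₀ ≟ v ⌋ ⟧ * g v) + sumℤ nF (λ f → 0ℤ * c f)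
        ≡⟨ split-row (λ v → ⟦ ⌊ v₀ ≟ v ⌋ ⟧) (λ _ → 0ℤ) ⟨
      rest            ≡⟨ pad₂ rest ⟩
      0ℤ * b + (0ℤ * m + rest) ≡⟨ proj₂ (proj₂ solution) zero ⟩
      0ℤ ∎
      where
      rest = sumℤ (nV ℕ.+ nF) (λ j → [ (λ v → ⟦ ⌊ v₀ ≟ v ⌋ ⟧) , (λ _ → 0ℤ) ]′ (splitAt nV j) * x (suc (suc j)))
      pad : ∀ r → r ≡ 1ℤ * r + 0ℤ
      pad = solve-∀
      pad₂ : ∀ r → r ≡ 0ℤ + (0ℤ + r)
      pad₂ = solve-∀
    δ-row : ∀ e → sumℤ nV (λ v → δ-entry e v * g v) ≡ δ g e
    δ-row e = begin
      sumℤ nV (λ v → δ-entry e v * g v)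
        ≡⟨ sum-cong nV (λ v → distrib ⟦ ⌊ tgt e ≟ v ⌋ ⟧ ⟦ ⌊ src e ≟ v ⌋ ⟧ (g v)) ⟩
      sumℤ nV (λ v → ⟦ ⌊ tgt e ≟ v ⌋ ⟧ * g v - ⟦ ⌊ src e ≟ v ⌋ ⟧ * g v)
        ≡⟨ sum-minus nV (λ v → ⟦ ⌊ tgt e ≟ v ⌋ ⟧ * g v) (λ v → ⟦ ⌊ src e ≟ v ⌋ ⟧ * g v) ⟩
      sumℤ nV (λ v → ⟦ ⌊ tgt e ≟ v ⌋ ⟧ * g v) - sumℤ nV (λ v → ⟦ ⌊ src e ≟ v ⌋ ⟧ * g v)
        ≡⟨ cong₂ _-_ (sum-if nV (tgt e) 1ℤ g) (sum-if nV (src e) 1ℤ g) ⟩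
      1ℤ * g (tgt e) - 1ℤ * g (src e) ≡⟨ cong₂ _-_ (ℤ.*-identityˡ (g (tgt e))) (ℤ.*-identityˡ (g (src e))) ⟩
      δ g e ∎
      where
      distrib : ∀ p q r → (p - q) * r ≡ p * r - q * r
      distrib = solve-∀
    if-* : ∀ (t : Bool) p q → (if t then p else 0ℤ) * q ≡ (if t then p * q else 0ℤ)
    if-* true  p q = refl
    if-* false p q = refl
    ∂-row : ∀ e → sumℤ nF (λ f → ∂-entry e f * c f) ≡ ∂ c e
    ∂-row e = sum-cong nF (λ f → trans
      (sym (sum-*ʳ 4 (c f) (λ a → if ⌊ side f a ≟ e ⌋ then orient f a else 0ℤ)))
      (sum-cong 4 (λ a → if-* ⌊ side f a ≟ e ⌋ (orient f a) (c f))))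
    cycle cocycle : Fin nE → ℤ
    cycle e = ∂ c e + outerCycle e * m
    cocycle e = δ g e + d e * b
    relation : ∀ e → cycle e ≡ - cocycle e
    relation e = isolate (∂ c e) (outerCycle e * m) (δ g e) (d e * b) (trans
      (cong (λ r → d e * b + (outerCycle e * m + r))
            (sym (trans (split-row (δ-entry e) (∂-entry e)) (cong₂ _+_ (δ-row e) (∂-row e)))))
      (proj₂ (proj₂ solution) (suc e)))
      where
      move : ∀ p z q s → p + z ≡ (s + (z + (q + p))) - (q + s)
      move = solve-∀
      isolate : ∀ p z q s → s + (z + (q + p)) ≡ 0ℤ → p + z ≡ - (q + s)
      isolate p z q s eq = trans (move p z q s)
        (trans (cong (_- (q + s)) eq) (ℤ.+-identityˡ (- (q + s))))
    cocycle-closed : Closed cocycle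
    cocycle-closed f = begin
      sumℤ 4 (λ a → orient f a * cocycle (side f a))
        ≡⟨ sum-cong 4 (λ a → distrib (orient f a) (δ g (side f a)) (d (side f a)) b) ⟩
      sumℤ 4 (λ a → orient f a * δ g (side f a) + orient f a * d (side f a) * b)
        ≡⟨ sum-+ 4 (λ a → orient f a * δ g (side f a)) (λ a → orient f a * d (side f a) * b) ⟩
      sumℤ 4 (λ a → orient f a * δ g (side f a)) + sumℤ 4 (λ a → orient f a * d (side f a) * b)
        ≡⟨ cong₂ _+_ (δ-closed g f) (trans (sum-*ʳ 4 b (λ a → orient f a * d (side f a)))
                                           (cong (_* b) (closed f))) ⟩
      0ℤ ∎
      where
      distrib : ∀ o p q r → o * (p + q * r) ≡ o * p + o * q * r
      distrib = solve-∀
    outerCycle-cocycle : pairing outerCycle cocycle ≡ 0ℤ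
    outerCycle-cocycle = begin
      pairing outerCycle cocycle
        ≡⟨ sum-cong nE (λ e → distrib (outerCycle e) (δ g e) (d e) b) ⟩
      sumℤ nE (λ e → outerCycle e * δ g e + outerCycle e * d e * b)
        ≡⟨ sum-+ nE (λ e → outerCycle e * δ g e) (λ e → outerCycle e * d e * b) ⟩
      pairing outerCycle (δ g) + sumℤ nE (λ e → outerCycle e * d e * b)
        ≡⟨ cong₂ _+_ (outerCycle-δ g) (trans (sum-*ʳ nE b (λ e → outerCycle e * d e))
                                             (cong (_* b) (outerCycle-orthogonal vanish))) ⟩
      0ℤ ∎
      where
      distrib : ∀ o p q r → o * (p + q * r) ≡ o * p + o * q * r
      distrib = solve-∀
    self-pairing : pairing cycle cycle ≡ 0ℤ
    self-pairing = begin
      pairing cycle cycle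
        ≡⟨ sum-cong nE (λ e → trans (cong (cycle e *_) (relation e))
                                    (distrib (∂ c e) (outerCycle e) m (cocycle e))) ⟩
      sumℤ nE (λ e → - (∂ c e * cocycle e) - m * (outerCycle e * cocycle e))
        ≡⟨ sum-minus nE (λ e → - (∂ c e * cocycle e)) (λ e → m * (outerCycle e * cocycle e)) ⟩
      sumℤ nE (λ e → - (∂ c e * cocycle e)) - sumℤ nE (λ e → m * (outerCycle e * cocycle e))
        ≡⟨ cong₂ _-_ (trans (sum-neg nE (λ e → ∂ c e * cocycle e)) (cong -_ (∂-orthogonal c {cocycle} cocycle-closed)))
                     (trans (sum-*ˡ nE m (λ e → outerCycle e * cocycle e))
                            (trans (cong (m *_) outerCycle-cocycle) (ℤ.*-zeroʳ m))) ⟩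
      0ℤ ∎
      where
      distrib : ∀ p z m q → (p + z * m) * - q ≡ - (p * q) - m * (z * q)
      distrib = solve-∀
    cycle≡0 : ∀ e → cycle e ≡ 0ℤ
    -- Positivity enters here: a sum of integer squares is zero only if every term is.
    cycle≡0 e = square≡0⇒≡0 (cycle e) (sum-nonNeg-≤0⇒0 nE {λ e → cycle e * cycle e}
      (λ e → 0≤square (cycle e)) (ℤ.≤-reflexive self-pairing) e)
    cocycle≡0 : ∀ e → cocycle e ≡ 0ℤ
    cocycle≡0 e = trans (sym (ℤ.neg-involutive (cocycle e))) (cong -_ (trans (sym (relation e)) (cycle≡0 e)))
    independent = ∂-outerCycle-independent c m cycle≡0
    b≢0 : b ≢ 0ℤ
    -- With `b` zero, `g` has zero coboundary, so it is constant with value `g v₀`, which is 0.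
    -- Together with `independent` this kills every coordinate of the nonzero solution.
    b≢0 b≡0 = proj₂ (proj₁ (proj₂ solution)) (x≡0 (proj₁ (proj₁ (proj₂ solution))))
      where
      δ≡0 : ∀ e → δ g e ≡ 0ℤ
      δ≡0 e = begin
        δ g e              ≡⟨ ℤ.+-identityʳ (δ g e) ⟨
        δ g e + 0ℤ         ≡⟨ cong (_+_ (δ g e)) (ℤ.*-zeroʳ (d e)) ⟨
        δ g e + d e * 0ℤ   ≡⟨ cong (λ z → δ g e + d e * z) b≡0 ⟨
        cocycle e          ≡⟨ cocycle≡0 e ⟩
        0ℤ ∎
      x≡0 : ∀ j → x j ≡ 0ℤ
      x≡0 zero       = b≡0
      x≡0 (suc zero) = proj₂ independent
      x≡0 (suc (suc j)) with split-cases nV nF j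
      ... | inj₁ (v , refl) = trans (δ≡0⇒constant g δ≡0 v v₀) g-v₀
      ... | inj₂ (f , refl) = proj₁ independent f
    potential : ∀ e → b * d e ≡ δ (-_ ∘ g) e
    potential e = begin
      b * d e                        ≡⟨ rearrange (g (tgt e)) (g (src e)) (d e) b ⟩
      cocycle e + δ (-_ ∘ g) e       ≡⟨ cong (_+ δ (-_ ∘ g) e) (cocycle≡0 e) ⟩
      0ℤ + δ (-_ ∘ g) e              ≡⟨ ℤ.+-identityˡ (δ (-_ ∘ g) e) ⟩
      δ (-_ ∘ g) e ∎
      where
      rearrange : ∀ t s d b → b * d ≡ (t - s + d * b) + (- t - - s)
      rearrange = solve-∀

  -- Colours and the flux across a single edge.

  -- A square lies to the left of the sides it traverses forwards. For the other sides the colour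
  -- opposite to its own is taken, which also gives a left colour to a boundary edge whose only
  -- square is on the right.
  leftIsBlack : Fin nF → Fin 4 → Bool
  leftIsBlack f a = if forward f a then black f else not (black f)

  -- Crossing a shared edge reverses both the direction of traversal and the colour, and the two
  -- reversals cancel.
  leftIsBlack-unique : ∀ f a g b → side f a ≡ side g b → leftIsBlack f a ≡ leftIsBlack g b
  leftIsBlack-unique f a g b eq with f ≟ g
  ... | yes refl = cong (leftIsBlack f) (side-injective f a b eq)
  ... | no f≢g rewrite forward-opposite f a g b eq f≢g | ¬-not (colouring f a g b eq f≢g) =
    flip (forward f a) (black g)
    where
    flip : ∀ o c → (if o then not c else not (not c)) ≡ (if not o then c else not c)
    flip true  c     = refl
    flip false true  = refl
    flip false false = refl

  abstract
    -- Opaque, so that later arguments see the colour only through `leftBlack-side` and not the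
    -- choice of an incident square.
    leftBlack : Fin nE → Bool
    leftBlack e = let f , a , _ = incident e in leftIsBlack f a

    leftBlack-side : ∀ f a → leftBlack (side f a) ≡ leftIsBlack f a
    leftBlack-side f a = let g , b , eq = incident (side f a) in leftIsBlack-unique g b f a eq

  -- The weight of a domino arrow crossing e from left to right of src e → tgt e.
  κ : Fin nE → ℤ
  κ e = sign (leftBlack e)

  -- Both factors change sign with the reference direction, so the product depends on the square
  -- alone. This lets the condition of one selected side per square be read as a statement about
  -- circulations.
  orient-κ : ∀ f a → orient f a * κ (side f a) ≡ sign (black f)
  orient-κ f a = trans (cong (λ c → orient f a * sign c) (leftBlack-side f a)) (signs (forward f a) (black f))
    where
    signs : ∀ o c → sign o * sign (if o then c else not c) ≡ sign c
    signs true  true  = refl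
    signs true  false = refl
    signs false true  = refl
    signs false false = refl

  open module TilingOf (t : Tiling A) = Tiling t

  -- The summand of `flux` for a cut edge `e` that the cut traverses starting from `v`.
  contribution : Tiling A → Fin nE → Fin nV → ℤ
  contribution t e v = sumℤ nF (λ f → sumℤ 4 (λ a →
    if sel t e ∧ ⌊ side f a ≟ e ⌋ ∧ ⌊ corner f a ≟ v ⌋ then sign (black f) else 0ℤ))

  leftSign : Fin nV → Fin nF → Fin 4 → ℤ
  leftSign v f a = if ⌊ corner f a ≟ v ⌋ then sign (black f) else 0ℤ

  contribution-unselected : ∀ t e v → sel t e ≡ false → contribution t e v ≡ 0ℤ
  contribution-unselected t e v s rewrite s = sum-zero nF (λ _ → refl)

  contribution-selected : ∀ t e v → sel t e ≡ true → contribution t e v ≡ incidenceSum e (leftSign v)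
  contribution-selected t e v s rewrite s =
    sum-cong nF (λ f → sum-cong 4 (λ a → if-∧ ⌊ side f a ≟ e ⌋ ⌊ corner f a ≟ v ⌋ (sign (black f))))
    where
    if-∧ : ∀ p q (x : ℤ) → (if p ∧ q then x else 0ℤ) ≡ (if p then (if q then x else 0ℤ) else 0ℤ)
    if-∧ true  q x = refl
    if-∧ false q x = refl

  leftSign-src : ∀ {e} f a → side f a ≡ e → leftSign (src e) f a ≡ (if forward f a then κ e else 0ℤ)
  leftSign-src f a refl = begin
    (if forward f a then sign (black f) else 0ℤ)
      ≡⟨ cong (λ z → if forward f a then z else 0ℤ) (orient-κ f a) ⟨
    (if forward f a then orient f a * κ (side f a) else 0ℤ)
      ≡⟨ simplify (forward f a) (κ (side f a)) ⟩
    (if forward f a then κ (side f a) else 0ℤ) ∎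
    where
    simplify : ∀ o k → (if o then sign o * k else 0ℤ) ≡ (if o then k else 0ℤ)
    simplify true  k = ℤ.*-identityˡ k
    simplify false k = refl

  leftSign-tgt : ∀ {e} f a → side f a ≡ e → leftSign (tgt e) f a ≡ (if forward f a then 0ℤ else - κ e)
  leftSign-tgt f a refl with orientation f a
  ... | inj₁ (_ , t , p) = begin
    leftSign (tgt (side f a)) f a
      ≡⟨ if-no (corner f a ≟ tgt (side f a)) (λ eq → next≢ a (corners-distinct f _ _ (sym (trans eq t)))) ⟩
    0ℤ ≡⟨ cong (λ o → if o then 0ℤ else - κ (side f a)) p ⟨
    (if forward f a then 0ℤ else - κ (side f a)) ∎
  ... | inj₂ (_ , t , p) = begin
    leftSign (tgt (side f a)) f a                  ≡⟨ if-yes (corner f a ≟ tgt (side f a)) (sym t) ⟩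
    sign (black f)                                 ≡⟨ orient-κ f a ⟨
    orient f a * κ (side f a)                      ≡⟨ cong (λ o → sign o * κ (side f a)) p ⟩
    -1ℤ * κ (side f a)                             ≡⟨ ℤ.-1*i≡-i (κ (side f a)) ⟩
    - κ (side f a)                                 ≡⟨ cong (λ o → if o then 0ℤ else - κ (side f a)) p ⟨
    (if forward f a then 0ℤ else - κ (side f a)) ∎

  -- Of the two squares at a selected edge exactly one traverses it forwards, and only that one is
  -- counted from `src e`. From `tgt e` the other one is counted, with the opposite colour.
  contribution-src : ∀ t e → contribution t e (src e) ≡ ⟦ sel t e ⟧ * κ e
  contribution-src t e = cases (sel t e) refl
    where
    collapse : ∀ o k → (if o then k else 0ℤ) + (if not o then k else 0ℤ) ≡ 1ℤ * k
    collapse true  k = trans (ℤ.+-identityʳ k) (sym (ℤ.*-identityˡ k))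
    collapse false k = trans (ℤ.+-identityˡ k) (sym (ℤ.*-identityˡ k))
    cases : ∀ s → sel t e ≡ s → contribution t e (src e) ≡ ⟦ s ⟧ * κ e
    cases false unselected = contribution-unselected t e (src e) unselected
    cases true  selected =
      let f , a , g , b , f≢g , p , q , _ , total = interior-incidence (sel-interior t e selected) in begin
      contribution t e (src e)      ≡⟨ contribution-selected t e (src e) selected ⟩
      incidenceSum e (leftSign (src e))       ≡⟨ total (leftSign (src e)) ⟩
      leftSign (src e) f a + leftSign (src e) g b
        ≡⟨ cong₂ _+_ (leftSign-src f a p) (leftSign-src g b q) ⟩
      (if forward f a then κ e else 0ℤ) + (if forward g b then κ e else 0ℤ)
        ≡⟨ cong (λ o → (if forward f a then κ e else 0ℤ) + (if o then κ e else 0ℤ))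
                (forward-opposite f a g b (trans p (sym q)) f≢g) ⟩
      (if forward f a then κ e else 0ℤ) + (if not (forward f a) then κ e else 0ℤ)
        ≡⟨ collapse (forward f a) (κ e) ⟩
      1ℤ * κ e ∎

  contribution-tgt : ∀ t e → contribution t e (tgt e) ≡ - (⟦ sel t e ⟧ * κ e)
  contribution-tgt t e = cases (sel t e) refl
    where
    collapse : ∀ o k → (if o then 0ℤ else - k) + (if not o then 0ℤ else - k) ≡ - (1ℤ * k)
    collapse true  k = trans (ℤ.+-identityˡ (- k)) (cong -_ (sym (ℤ.*-identityˡ k)))
    collapse false k = trans (ℤ.+-identityʳ (- k)) (cong -_ (sym (ℤ.*-identityˡ k)))
    cases : ∀ s → sel t e ≡ s → contribution t e (tgt e) ≡ - (⟦ s ⟧ * κ e)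
    cases false unselected = contribution-unselected t e (tgt e) unselected
    cases true  selected =
      let f , a , g , b , f≢g , p , q , _ , total = interior-incidence (sel-interior t e selected) in begin
      contribution t e (tgt e)      ≡⟨ contribution-selected t e (tgt e) selected ⟩
      incidenceSum e (leftSign (tgt e))       ≡⟨ total (leftSign (tgt e)) ⟩
      leftSign (tgt e) f a + leftSign (tgt e) g b
        ≡⟨ cong₂ _+_ (leftSign-tgt f a p) (leftSign-tgt g b q) ⟩
      (if forward f a then 0ℤ else - κ e) + (if forward g b then 0ℤ else - κ e)
        ≡⟨ cong (λ o → (if forward f a then 0ℤ else - κ e) + (if o then 0ℤ else - κ e))
                (forward-opposite f a g b (trans p (sym q)) f≢g) ⟩
      (if forward f a then 0ℤ else - κ e) + (if not (forward f a) then 0ℤ else - κ e)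
        ≡⟨ collapse (forward f a) (κ e) ⟩
      - (1ℤ * κ e) ∎

  -- The difference cocycle of two tilings and the independence of flux differences from the cut.

  -- One quarter of the increment, from `src e` to `tgt e`, of the difference of the two height
  -- functions.
  change : Tiling A → Tiling A → Fin nE → ℤ
  change t t' e = κ e * (⟦ sel t' e ⟧ - ⟦ sel t e ⟧)

  -- Along each cut edge the scaled difference of contributions is an increment of `g`, and the
  -- increments telescope. The scale `b` is there because the potential is obtained only up to a
  -- nonzero factor.
  flux-change : ∀ t t' b g → (∀ e → b * change t t' e ≡ δ g e) → ∀ ξ →
    b * (flux A t' ξ - flux A t ξ) ≡ g (Cut.vtx ξ (fromℕ (Cut.len ξ))) - g (Cut.vtx ξ zero)
  flux-change t t' b g potential ξ = begin
    b * (flux A t' ξ - flux A t ξ)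
      ≡⟨ cong (b *_) (sum-minus len (λ i → contribution t' (edg i) (vtx (inject₁ i)))
                                    (λ i → contribution t (edg i) (vtx (inject₁ i)))) ⟨
    b * sumℤ len (λ i → difference (edg i) (vtx (inject₁ i)))
      ≡⟨ sum-*ˡ len b (λ i → difference (edg i) (vtx (inject₁ i))) ⟨
    sumℤ len (λ i → b * difference (edg i) (vtx (inject₁ i)))
      ≡⟨ sum-cong len (λ i → step (edg i) (edg-joins i)) ⟩
    sumℤ len (λ i → g (vtx (suc i)) - g (vtx (inject₁ i)))
      ≡⟨ sum-telescope len (g ∘ vtx) ⟩
    g (vtx (fromℕ len)) - g (vtx zero) ∎
    where
    open Cut ξ
    difference : Fin nE → Fin nV → ℤ
    difference e v = contribution t' e v - contribution t e v
    factor : ∀ b k x y → b * (x * k - y * k) ≡ b * (k * (x - y))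
    factor = solve-∀
    factor₋ : ∀ b k x y → b * (- (x * k) - - (y * k)) ≡ - (b * (k * (x - y)))
    factor₋ = solve-∀
    neg-minus : ∀ x y → - (x - y) ≡ y - x
    neg-minus = solve-∀
    step : ∀ e {v w} → Joins A e v w → b * difference e v ≡ g w - g v
    step e (inj₁ (refl , refl)) = begin
      b * difference e (src e)
        ≡⟨ cong (b *_) (cong₂ _-_ (contribution-src t' e) (contribution-src t e)) ⟩
      b * (⟦ sel t' e ⟧ * κ e - ⟦ sel t e ⟧ * κ e)
        ≡⟨ factor b (κ e) ⟦ sel t' e ⟧ ⟦ sel t e ⟧ ⟩
      b * change t t' e  ≡⟨ potential e ⟩
      δ g e ∎
    step e (inj₂ (refl , refl)) = begin
      b * difference e (tgt e)
        ≡⟨ cong (b *_) (cong₂ _-_ (contribution-tgt t' e) (contribution-tgt t e)) ⟩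
      b * (- (⟦ sel t' e ⟧ * κ e) - - (⟦ sel t e ⟧ * κ e))
        ≡⟨ factor₋ b (κ e) ⟦ sel t' e ⟧ ⟦ sel t e ⟧ ⟩
      - (b * change t t' e)  ≡⟨ cong -_ (potential e) ⟩
      - δ g e                ≡⟨ neg-minus (g (tgt e)) (g (src e)) ⟩
      g (src e) - g (tgt e) ∎

  boundary-unselected : ∀ t e → BoundaryEdge A e → sel t e ≡ false
  boundary-unselected t e be with sel t e in s
  ... | false = refl
  ... | true  = ⊥-elim (ℕ.1+n≢n (trans (sym (sel-interior t e s)) be))

  sel-square : ∀ t f → sumℤ 4 (λ a → ⟦ sel t (side f a) ⟧) ≡ 1ℤ
  sel-square t f = trans (sym (count-⟦⟧ 4 (λ a → sel t (side f a)))) (cong +_ (one-per-sq t f))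

  -- By `orient-κ` the circulation around a square is its colour sign times the difference of two
  -- selected-side counts, both equal to 1.
  change-closed : ∀ t t' → Closed (change t t')
  change-closed t t' f = begin
    sumℤ 4 (λ a → orient f a * change t t' (side f a))
      ≡⟨ sum-cong 4 (λ a → trans (sym (ℤ.*-assoc (orient f a) (κ (side f a)) (s' a - s a)))
                                 (cong (_* (s' a - s a)) (orient-κ f a))) ⟩
    sumℤ 4 (λ a → sign (black f) * (s' a - s a))
      ≡⟨ sum-*ˡ 4 (sign (black f)) (λ a → s' a - s a) ⟩
    sign (black f) * sumℤ 4 (λ a → s' a - s a)
      ≡⟨ cong (sign (black f) *_) (trans (sum-minus 4 s' s) (cong₂ _-_ (sel-square t' f) (sel-square t f))) ⟩
    sign (black f) * 0ℤ ≡⟨ ℤ.*-zeroʳ (sign (black f)) ⟩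
    0ℤ ∎
    where
    s s' : Fin 4 → ℤ
    s a = ⟦ sel t (side f a) ⟧
    s' a = ⟦ sel t' (side f a) ⟧

  change-boundary : ∀ t t' → VanishesOnBoundary (change t t')
  change-boundary t t' e be = trans
    (cong₂ (λ x y → κ e * (⟦ x ⟧ - ⟦ y ⟧)) (boundary-unselected t' e be) (boundary-unselected t e be))
    (ℤ.*-zeroʳ (κ e))

  -- The difference cocycle is zero on boundary edges, so its potential is constant on each boundary
  -- component. The scaled flux difference is the inner value minus the outer value for every cut,
  -- and the scale cancels.
  flux-difference-independent : ∀ t t' ξ ξ' →
    flux A t' ξ - flux A t ξ ≡ flux A t' ξ' - flux A t ξ'
  flux-difference-independent t t' ξ ξ' =
    let b , b≢0 , g , potential = rational-potential (change-closed t t') (change-boundary t t')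
    in *-cancelˡ-≢0 b b≢0 (difference b g potential)
    where
    start end : Cut A → Fin nV
    start ξ = Cut.vtx ξ zero
    end ξ = Cut.vtx ξ (fromℕ (Cut.len ξ))
    module _ (b : ℤ) (g : Fin nV → ℤ) (potential : ∀ e → b * change t t' e ≡ δ g e) where
      boundary-step : ∀ e → BoundaryEdge A e → g (tgt e) ≡ g (src e)
      boundary-step e be = ℤ.i-j≡0⇒i≡j (g (tgt e)) (g (src e))
        (trans (sym (potential e)) (trans (cong (b *_) (change-boundary t t' e be)) (ℤ.*-zeroʳ b)))
      along : ∀ {u v} → Star (BoundaryAdj A) u v → g u ≡ g v
      along ε = refl
      along ((e , be , inj₁ (refl , refl)) ◅ path) = trans (sym (boundary-step e be)) (along path)
      along ((e , be , inj₂ (refl , refl)) ◅ path) = trans (boundary-step e be) (along path)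
      difference : b * (flux A t' ξ - flux A t ξ) ≡ b * (flux A t' ξ' - flux A t ξ')
      difference = begin
        b * (flux A t' ξ - flux A t ξ)     ≡⟨ flux-change t t' b g potential ξ ⟩
        g (end ξ) - g (start ξ)
          ≡⟨ cong₂ _-_ (along (inner-connected (end ξ) (end ξ') (Cut.ends-inner ξ) (Cut.ends-inner ξ')))
                       (along (outer-connected (start ξ) (start ξ') (Cut.starts-outer ξ) (Cut.starts-outer ξ'))) ⟩
        g (end ξ') - g (start ξ')          ≡⟨ flux-change t t' b g potential ξ' ⟨
        b * (flux A t' ξ' - flux A t ξ') ∎

  -- Directed edges and raising a tiling across a separating set.

  -- Edges are directed with the white square on the left.
  tail head : Fin nE → Fin nV
  tail e = if leftBlack e then tgt e else src e
  head e = if leftBlack e then src e else tgt e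

  tail-head-joins : ∀ e → Joins A e (tail e) (head e)
  tail-head-joins e with leftBlack e
  ... | true  = inj₂ (refl , refl)
  ... | false = inj₁ (refl , refl)

  -- A square is on the left of its own sides taken counterclockwise. Hence every square is bounded
  -- by a directed 4-cycle, counterclockwise if white and clockwise if black.
  tail-head-white : ∀ f a → black f ≡ false →
                    tail (side f a) ≡ corner f a × head (side f a) ≡ corner f (next a)
  tail-head-white f a c with orientation f a
  ... | inj₁ (s , t , p) rewrite leftBlack-side f a | p | c = s , t
  ... | inj₂ (s , t , p) rewrite leftBlack-side f a | p | c = t , s

  tail-head-black : ∀ f a → black f ≡ true →
                    tail (side f a) ≡ corner f (next a) × head (side f a) ≡ corner f a
  tail-head-black f a c with orientation f a
  ... | inj₁ (s , t , p) rewrite leftBlack-side f a | p | c = t , s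
  ... | inj₂ (s , t , p) rewrite leftBlack-side f a | p | c = s , t

  -- Seen from the tail, white is on the left, so the arrow of a domino across the edge points from
  -- right to left.
  contribution-tail : ∀ t e → contribution t e (tail e) ≡ - ⟦ sel t e ⟧
  contribution-tail t e = cases (leftBlack e) refl
    where
    cases : ∀ c → leftBlack e ≡ c → contribution t e (if c then tgt e else src e) ≡ - ⟦ sel t e ⟧
    cases true  lb = trans (contribution-tgt t e)
      (trans (cong (λ c → - (⟦ sel t e ⟧ * sign c)) lb) (cong -_ (ℤ.*-identityʳ ⟦ sel t e ⟧)))
    cases false lb = trans (contribution-src t e) (trans (cong (λ c → ⟦ sel t e ⟧ * sign c) lb)
      (trans (ℤ.*-comm ⟦ sel t e ⟧ -1ℤ) (ℤ.-1*i≡-i ⟦ sel t e ⟧)))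

  -- Such a set certifies that no directed path of unselected edges leads from the outer to the
  -- inner boundary.
  record Separation (t : Tiling A) : Set where
    field
      inside      : Fin nV → Bool
      inner-in    : ∀ v → InnerBoundaryVertex A v → inside v ≡ true
      outer-out   : ∀ v → OuterBoundaryVertex A v → inside v ≡ false
      backward    : ∀ e → sel t e ≡ false → inside (head e) ≡ true → inside (tail e) ≡ true

  -- Adding the indicator of a separating set (times 4, in the usual normalisation) to
  -- the height function keeps it a height function and raises the flux by one.
  module Raise (t : Tiling A) (S : Separation t) where
    open Separation S

    others-unselected : ∀ f a b → sel t (side f a) ≡ true → b ≢ a → sel t (side f b) ≡ false
    others-unselected f a b s b≢a = count≡1⇒others 4 (λ a → sel t (side f a)) (one-per-sq t f) s b≢a

    -- The three other sides of a square containing e lead from head e to tail e.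
    forward-closed : ∀ e → sel t e ≡ true → inside (tail e) ≡ true → inside (head e) ≡ true
    forward-closed e s in-tail with incident e
    ... | f , a , refl with black f in c
    ... | false = subst (λ v → inside v ≡ true) (sym (proj₂ (tail-head-white f a c)))
      (back (next a) (next≢ a) (back (next (next a)) (next-next≢ a) (back (next (next (next a))) (next³≢ a)
        (subst (λ v → inside v ≡ true)
          (trans (proj₁ (tail-head-white f a c)) (cong (corner f) (sym (next⁴ a)))) in-tail))))
      where
      back : ∀ b → b ≢ a → inside (corner f (next b)) ≡ true → inside (corner f b) ≡ true
      back b b≢a p = let tl , hd = tail-head-white f b c in
        subst (λ v → inside v ≡ true) tl (backward (side f b) (others-unselected f a b s b≢a)
          (subst (λ v → inside v ≡ true) (sym hd) p))
    ... | true = subst (λ v → inside v ≡ true) (trans (cong (corner f) (next⁴ a)) (sym (proj₂ (tail-head-black f a c))))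
      (back (next (next (next a))) (next³≢ a) (back (next (next a)) (next-next≢ a) (back (next a) (next≢ a)
        (subst (λ v → inside v ≡ true) (proj₁ (tail-head-black f a c)) in-tail))))
      where
      back : ∀ b → b ≢ a → inside (corner f b) ≡ true → inside (corner f (next b)) ≡ true
      back b b≢a p = let tl , hd = tail-head-black f b c in
        subst (λ v → inside v ≡ true) tl (backward (side f b) (others-unselected f a b s b≢a)
          (subst (λ v → inside v ≡ true) (sym hd) p))

    height : Fin nV → ℤ
    height v = ⟦ inside v ⟧

    raised : Fin nE → Bool
    raised e = sel t e xor (inside (tail e) xor inside (head e))

    -- An edge entering the set is selected, by `backward`; an edge leaving it is unselected, by
    -- `forward-closed`. The first kind is dropped and the second added, so `xor` agrees with
    -- integer addition.
    raised-⟦⟧ : ∀ e → ⟦ raised e ⟧ ≡ ⟦ sel t e ⟧ + (height (tail e) - height (head e))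
    raised-⟦⟧ e = table (sel t e) (inside (tail e)) (inside (head e)) (forward-closed e) (backward e)
      where
      table : ∀ s x y → (s ≡ true → x ≡ true → y ≡ true) → (s ≡ false → y ≡ true → x ≡ true) →
              ⟦ s xor (x xor y) ⟧ ≡ ⟦ s ⟧ + (⟦ x ⟧ - ⟦ y ⟧)
      table true  true  true  _ _ = refl
      table true  true  false p _ with () ← p refl refl
      table true  false true  _ _ = refl
      table true  false false _ _ = refl
      table false true  true  _ _ = refl
      table false true  false _ _ = refl
      table false false true  _ q with () ← q refl refl
      table false false false _ _ = refl

    boundary-level : ∀ e → BoundaryEdge A e → inside (src e) ≡ inside (tgt e)
    boundary-level e be with outer (src e) in o
    ... | true  = trans (outer-out (src e) ((e , be , inj₁ refl) , o))
                        (sym (outer-out (tgt e) ((e , be , inj₂ refl) , trans (sym (outer-label be)) o)))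
    ... | false = trans (inner-in (src e) ((e , be , inj₁ refl) , o))
                        (sym (inner-in (tgt e) ((e , be , inj₂ refl) , trans (sym (outer-label be)) o)))

    raised-boundary : ∀ e → BoundaryEdge A e → raised e ≡ false
    raised-boundary e be = trans
      (cong (λ s → s xor (inside (tail e) xor inside (head e))) (boundary-unselected t e be))
      (ends (leftBlack e))
      where
      ends : ∀ c → inside (if c then tgt e else src e) xor inside (if c then src e else tgt e) ≡ false
      ends true  = trans (cong (inside (tgt e) xor_) (boundary-level e be)) (xor-same (inside (tgt e)))
      ends false = trans (cong (_xor inside (tgt e)) (boundary-level e be)) (xor-same (inside (tgt e)))

    -- The sides form a directed cycle, so the differences cancel. This is why a square keeps
    -- exactly one selected side.
    height-square : ∀ f → sumℤ 4 (λ a → height (tail (side f a)) - height (head (side f a))) ≡ 0ℤ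
    height-square f with black f in c
    ... | false = begin
      sumℤ 4 (λ a → height (tail (side f a)) - height (head (side f a)))
        ≡⟨ sum-cong 4 (λ a → cong₂ (λ u v → height u - height v) (proj₁ (tail-head-white f a c)) (proj₂ (tail-head-white f a c))) ⟩
      sumℤ 4 (λ a → height (corner f a) - height (corner f (next a)))
        ≡⟨ sum-minus 4 (height ∘ corner f) (height ∘ corner f ∘ next) ⟩
      sumℤ 4 (height ∘ corner f) - sumℤ 4 (height ∘ corner f ∘ next)
        ≡⟨ ℤ.i≡j⇒i-j≡0 (sym (sum-cyclic (height ∘ corner f))) ⟩
      0ℤ ∎
    ... | true = begin
      sumℤ 4 (λ a → height (tail (side f a)) - height (head (side f a)))
        ≡⟨ sum-cong 4 (λ a → cong₂ (λ u v → height u - height v) (proj₁ (tail-head-black f a c)) (proj₂ (tail-head-black f a c))) ⟩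
      sumℤ 4 (λ a → height (corner f (next a)) - height (corner f a))
        ≡⟨ sum-minus 4 (height ∘ corner f ∘ next) (height ∘ corner f) ⟩
      sumℤ 4 (height ∘ corner f ∘ next) - sumℤ 4 (height ∘ corner f)
        ≡⟨ ℤ.i≡j⇒i-j≡0 (sum-cyclic (height ∘ corner f)) ⟩
      0ℤ ∎

    raisedTiling : Tiling A
    raisedTiling = record
      { sel = raised
      ; sel-interior = interior
      ; one-per-sq = λ f → ℤ.+-injective (begin
          + count 4 (λ a → raised (side f a))    ≡⟨ count-⟦⟧ 4 (λ a → raised (side f a)) ⟩
          sumℤ 4 (λ a → ⟦ raised (side f a) ⟧)   ≡⟨ sum-cong 4 (λ a → raised-⟦⟧ (side f a)) ⟩
          sumℤ 4 (λ a → ⟦ sel t (side f a) ⟧ + (height (tail (side f a)) - height (head (side f a))))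
            ≡⟨ sum-+ 4 (λ a → ⟦ sel t (side f a) ⟧) (λ a → height (tail (side f a)) - height (head (side f a))) ⟩
          sumℤ 4 (λ a → ⟦ sel t (side f a) ⟧) + sumℤ 4 (λ a → height (tail (side f a)) - height (head (side f a)))
            ≡⟨ cong₂ _+_ (sel-square t f) (height-square f) ⟩
          1ℤ ∎)
      }
      where
      interior : ∀ e → raised e ≡ true → InteriorEdge A e
      interior e r with edge-sides e
      ... | inj₂ ie = ie
      ... | inj₁ be with () ← trans (sym r) (raised-boundary e be)

    raised-change : ∀ e → 1ℤ * change t raisedTiling e ≡ δ height e
    raised-change e = begin
      1ℤ * change t raisedTiling e                       ≡⟨ ℤ.*-identityˡ (change t raisedTiling e) ⟩
      κ e * (⟦ raised e ⟧ - ⟦ sel t e ⟧)                 ≡⟨ cong (λ r → κ e * (r - ⟦ sel t e ⟧)) (raised-⟦⟧ e) ⟩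
      κ e * (⟦ sel t e ⟧ + (height (tail e) - height (head e)) - ⟦ sel t e ⟧)
        ≡⟨ cong (κ e *_) (cancel ⟦ sel t e ⟧ (height (tail e) - height (head e))) ⟩
      κ e * (height (tail e) - height (head e))          ≡⟨ undirect (leftBlack e) ⟩
      δ height e ∎
      where
      cancel : ∀ s d → s + d - s ≡ d
      cancel = solve-∀
      flip : ∀ x y → -1ℤ * (x - y) ≡ y - x
      flip = solve-∀
      undirect : ∀ c → sign c * (height (if c then tgt e else src e) - height (if c then src e else tgt e)) ≡ δ height e
      undirect true  = ℤ.*-identityˡ (δ height e)
      undirect false = flip (height (src e)) (height (tgt e))

    -- The indicator of the set is a potential of the change with scale 1, and every cut runs from
    -- value 0 to value 1.
    raised-flux : ∀ ξ → flux A raisedTiling ξ ≡ flux A t ξ + 1ℤ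
    raised-flux ξ = begin
      flux A raisedTiling ξ
        ≡⟨ rearrange (flux A raisedTiling ξ) (flux A t ξ) ⟩
      flux A t ξ + 1ℤ * (flux A raisedTiling ξ - flux A t ξ)
        ≡⟨ cong (_+_ (flux A t ξ)) (flux-change t raisedTiling 1ℤ height raised-change ξ) ⟩
      flux A t ξ + (height (vtx (fromℕ len)) - height (vtx zero))
        ≡⟨ cong₂ (λ x y → flux A t ξ + (⟦ x ⟧ - ⟦ y ⟧)) (inner-in (vtx (fromℕ len)) ends-inner) (outer-out (vtx zero) starts-outer) ⟩
      flux A t ξ + 1ℤ ∎
      where
      open Cut ξ
      rearrange : ∀ x y → x ≡ y + 1ℤ * (x - y)
      rearrange = solve-∀

  -- Search for a directed path of unselected edges.

  -- Partial cuts built backwards from the inner boundary. The field `within` is what keeps the path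
  -- simple when a vertex not yet in `inside` is prepended.
  record Descent (t : Tiling A) (inside : Fin nV → Bool) (v : Fin nV) : Set where
    field
      len        : ℕ
      vtx        : Fin (suc len) → Fin nV
      edg        : Fin len → Fin nE
      starts     : vtx zero ≡ v
      tails      : ∀ i → tail (edg i) ≡ vtx (inject₁ i)
      heads      : ∀ i → head (edg i) ≡ vtx (suc i)
      unselected : ∀ i → sel t (edg i) ≡ false
      within     : ∀ i → inside (vtx i) ≡ true
      simple     : ∀ i j → vtx i ≡ vtx j → i ≡ j
      ends-inner : InnerBoundaryVertex A (vtx (fromℕ len))
      only-end   : ∀ i → BoundaryVertex A (vtx i) → i ≡ fromℕ len

  -- The field `tails` says that the cut follows the edge directions, so that every domino across
  -- it, of any tiling, counts with the same sign.
  record Barrier (t : Tiling A) : Set where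
    field
      cut        : Cut A
      tails      : ∀ i → tail (Cut.edg cut i) ≡ Cut.vtx cut (inject₁ i)
      unselected : ∀ i → sel t (Cut.edg cut i) ≡ false

  boundaryVertex? : ∀ v → Dec (BoundaryVertex A v)
  boundaryVertex? v = any? (λ e → (sideCount A e ℕ.≟ 1) ×-dec ((src e ≟ v) ⊎-dec (tgt e ≟ v)))

  module Search (t : Tiling A) where

    module Extend {inside : Fin nV → Bool} (e : Fin nE) (sel-e : sel t e ≡ false)
                  (fresh : inside (tail e) ≡ false) (D : Descent t inside (head e)) where
      open Descent D

      vtx⁺ : Fin (suc (suc len)) → Fin nV
      vtx⁺ zero    = tail e
      vtx⁺ (suc i) = vtx i

      edg⁺ : Fin (suc len) → Fin nE
      edg⁺ zero    = e
      edg⁺ (suc i) = edg i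

      tails⁺ : ∀ i → tail (edg⁺ i) ≡ vtx⁺ (inject₁ i)
      tails⁺ zero    = refl
      tails⁺ (suc i) = tails i

      heads⁺ : ∀ i → head (edg⁺ i) ≡ vtx⁺ (suc i)
      heads⁺ zero    = sym starts
      heads⁺ (suc i) = heads i

      unselected⁺ : ∀ i → sel t (edg⁺ i) ≡ false
      unselected⁺ zero    = sel-e
      unselected⁺ (suc i) = unselected i

      new : ∀ i → tail e ≢ vtx i
      new i eq with () ← trans (sym fresh) (trans (cong inside eq) (within i))

      simple⁺ : ∀ i j → vtx⁺ i ≡ vtx⁺ j → i ≡ j
      simple⁺ zero    zero    eq = refl
      simple⁺ zero    (suc j) eq = ⊥-elim (new j eq)
      simple⁺ (suc i) zero    eq = ⊥-elim (new i (sym eq))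
      simple⁺ (suc i) (suc j) eq = cong suc (simple i j eq)

      barrier : OuterBoundaryVertex A (tail e) → Barrier t
      barrier outer-v = record
        { cut = record
          { len = suc len ; vtx = vtx⁺ ; edg = edg⁺
          ; edg-joins = λ i → subst₂ (Joins A (edg⁺ i)) (tails⁺ i) (heads⁺ i) (tail-head-joins (edg⁺ i))
          ; simple = simple⁺
          ; starts-outer = outer-v
          ; ends-inner = ends-inner
          ; only-endpoints = λ { zero _ → inj₁ refl ; (suc i) b → inj₂ (cong suc (only-end i b)) } }
        ; tails = tails⁺
        ; unselected = unselected⁺ }

      descent : ¬ BoundaryVertex A (tail e) → Descent t (insert (tail e) inside) (tail e)
      descent ¬b = record
        { len = suc len ; vtx = vtx⁺ ; edg = edg⁺
        ; starts = refl
        ; tails = tails⁺ ; heads = heads⁺ ; unselected = unselected⁺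
        ; within = λ { zero → insert-self (tail e) inside ; (suc i) → insert-⊇ (tail e) inside (within i) }
        ; simple = simple⁺
        ; ends-inner = ends-inner
        ; only-end = λ { zero b → ⊥-elim (¬b b) ; (suc i) b → cong suc (only-end i b) } }

    weaken : ∀ {p q v} → (∀ {w} → p w ≡ true → q w ≡ true) → Descent t p v → Descent t q v
    weaken p⊆q D = record
      { len = len ; vtx = vtx ; edg = edg ; starts = starts ; tails = tails ; heads = heads
      ; unselected = unselected ; within = λ i → p⊆q (within i) ; simple = simple
      ; ends-inner = ends-inner ; only-end = only-end }
      where open Descent D

    extendable? : ∀ (inside : Fin nV → Bool) →
      Dec (∃ λ e → sel t e ≡ false × inside (head e) ≡ true × inside (tail e) ≡ false)
    extendable? inside = any? (λ e →
      (sel t e Bool.≟ false) ×-dec ((inside (head e) Bool.≟ true) ×-dec (inside (tail e) Bool.≟ false)))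

    -- Backward search along unselected edges. A set that cannot grow is a separation; a tail on the
    -- outer boundary completes a cut; any other new tail is added to the set. The fuel always
    -- covers the vertices not yet reached.
    explore : ∀ fuel (inside : Fin nV → Bool) → nV ℕ.≤ count nV inside ℕ.+ fuel →
      (∀ v → InnerBoundaryVertex A v → inside v ≡ true) →
      (∀ v → OuterBoundaryVertex A v → inside v ≡ false) →
      (∀ v → inside v ≡ true → Descent t inside v) → Barrier t ⊎ Separation t
    explore fuel inside enough inner-in outer-out descents with extendable? inside
    ... | no stuck = inj₂ (record
      { inside = inside ; inner-in = inner-in ; outer-out = outer-out
      ; backward = λ e s h → ¬-not (λ fresh → stuck (e , s , h , fresh)) })
    ... | yes (e , s , h , fresh) with boundaryVertex? (tail e) | outer (tail e) in o
    ... | yes b | true  = inj₁ (Extend.barrier e s fresh (descents (head e) h) (b , o))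
    -- The inner boundary is in the set from the start, so a fresh boundary vertex must be outer.
    ... | yes b | false with () ← trans (sym fresh) (inner-in (tail e) (b , o))
    ... | no ¬b | _ with fuel
    -- Without fuel the set already has `nV` elements, yet a fresh vertex could still be added.
    ... | zero = ⊥-elim (ℕ.<⇒≱ (subst (ℕ._≤ nV) (count-insert nV (tail e) inside fresh) (count≤ nV (insert (tail e) inside)))
                               (subst (nV ℕ.≤_) (ℕ.+-identityʳ (count nV inside)) enough))
    ... | suc fuel = explore fuel (insert (tail e) inside)
      (subst (nV ℕ.≤_) (trans (ℕ.+-suc (count nV inside) fuel)
                              (cong (ℕ._+ fuel) (sym (count-insert nV (tail e) inside fresh)))) enough)
      (λ v inner-v → insert-⊇ (tail e) inside (inner-in v inner-v))
      (λ v outer-v → ¬-not (λ i → [ (λ eq → ¬b (subst (BoundaryVertex A) (sym eq) (proj₁ outer-v)))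
                                  , (λ i → true≢false (trans (sym i) (outer-out v outer-v))) ]′
                                  (insert-⁻ (tail e) inside i)))
      (λ v i → [ (λ eq → subst (Descent t (insert (tail e) inside)) eq
                                (Extend.descent e s fresh (descents (head e) h) ¬b))
               , (λ i → weaken (insert-⊇ (tail e) inside) (descents v i)) ]′
               (insert-⁻ (tail e) inside i))
      where
      true≢false : true ≢ false
      true≢false ()

    innerBoundary? : ∀ v → Dec (InnerBoundaryVertex A v)
    innerBoundary? v = boundaryVertex? v ×-dec (outer v Bool.≟ false)

    barrier-or-separation : Barrier t ⊎ Separation t
    barrier-or-separation = explore nV onInner (ℕ.m≤n+m nV (count nV onInner))
      (λ v → ⌊⌋≡true (innerBoundary? v))
      (λ v outer-v → ⌊⌋≡false (innerBoundary? v) (λ inner-v → different (trans (sym (proj₂ outer-v)) (proj₂ inner-v))))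
      -- The initial set is the inner boundary itself, each vertex carrying the path of length 0.
      (λ v i → record
        { len = 0 ; vtx = λ _ → v ; edg = λ () ; starts = refl
        ; tails = λ () ; heads = λ () ; unselected = λ () ; within = λ _ → i
        ; simple = λ { zero zero _ → refl }
        ; ends-inner = ⌊⌋-witness (innerBoundary? v) i
        ; only-end = λ { zero _ → refl } })
      where
      onInner : Fin nV → Bool
      onInner v = ⌊ innerBoundary? v ⌋
      different : true ≢ false
      different ()

  -- Tilings of maximal flux.

  -- A crude bound of one unit per cut edge, square and side; it only has to stop the climb in
  -- `barrier-exists`.
  fluxBound : Cut A → ℕ
  fluxBound ξ = Cut.len ξ ℕ.* (nF ℕ.* (4 ℕ.* 1))

  flux≤bound : ∀ t ξ → flux A t ξ ≤ + fluxBound ξ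
  flux≤bound t ξ = sum-upper len (nF ℕ.* (4 ℕ.* 1)) (λ i → sum-upper nF (4 ℕ.* 1) (λ f → sum-upper 4 1 (λ a →
    weight≤1 (sel t (edg i) ∧ ⌊ side f a ≟ edg i ⌋ ∧ ⌊ corner f a ≟ vtx (inject₁ i) ⌋) (black f))))
    where
    open Cut ξ
    weight≤1 : ∀ p c → (if p then sign c else 0ℤ) ≤ 1ℤ
    weight≤1 true  true  = ℤ.≤-refl
    weight≤1 true  false = ℤ.-≤+
    weight≤1 false c     = ℤ.+≤+ ℕ.z≤n

  -- Induction on the gap between the flux and its bound: as long as a separation is found, raising
  -- the tiling closes the gap by one.
  barrier-exists : Cut A → Tiling A → ∃ Barrier
  barrier-exists ξ t₀ = climb ℤ.∣ + fluxBound ξ - flux A t₀ ξ ∣ t₀ enough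
    where
    bound = + fluxBound ξ
    enough : bound ≤ flux A t₀ ξ + + ℤ.∣ bound - flux A t₀ ξ ∣
    enough = ℤ.≤-reflexive (begin
      bound                                         ≡⟨ split bound (flux A t₀ ξ) ⟩
      flux A t₀ ξ + (bound - flux A t₀ ξ)           ≡⟨ cong (_+_ (flux A t₀ ξ)) (ℤ.0≤i⇒+∣i∣≡i (ℤ.i≤j⇒0≤j-i (flux≤bound t₀ ξ))) ⟨
      flux A t₀ ξ + + ℤ.∣ bound - flux A t₀ ξ ∣ ∎)
      where
      split : ∀ x y → x ≡ y + (x - y)
      split = solve-∀
    climb : ∀ k t → bound ≤ flux A t ξ + + k → ∃ Barrier
    climb k t le with Search.barrier-or-separation t
    ... | inj₁ B = t , B
    ... | inj₂ S with k
    ... | suc k = climb k (Raise.raisedTiling t S) (subst (bound ≤_)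
      (trans (sym (ℤ.+-assoc (flux A t ξ) 1ℤ (+ k))) (cong (_+ + k) (sym (Raise.raised-flux t S ξ)))) le)
    -- At gap 0 one more raise would push the flux past its bound.
    ... | zero = ⊥-elim (ℤ.<-irrefl refl (ℤ.suc[i]≤j⇒i<j (ℤ.≤-trans
      (subst (_≤ bound) (trans (Raise.raised-flux t S ξ) (ℤ.+-comm (flux A t ξ) 1ℤ))
             (flux≤bound (Raise.raisedTiling t S) ξ))
      (subst (bound ≤_) (ℤ.+-identityʳ (flux A t ξ)) le))))

  flux-barrier : ∀ {t} (B : Barrier t) t' → let ξ = Barrier.cut B in
    flux A t' ξ ≡ - sumℤ (Cut.len ξ) (λ i → ⟦ sel t' (Cut.edg ξ i) ⟧)
  flux-barrier B t' = trans
    (sum-cong len (λ i → trans (cong (contribution t' (edg i)) (sym (tails i))) (contribution-tail t' (edg i))))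
    (sum-neg len (λ i → ⟦ sel t' (edg i) ⟧))
    where
    open Barrier B
    open Cut cut

  -- The barrier is built once from `t₀`, so a single cut serves all maximal tilings. Relative to it
  -- a maximal tiling has flux at least that of `t₁`, which is 0, while `flux-barrier` makes the
  -- flux minus the number of trespassing edges.
  max-flux-cut : Tiling A → ∀ ξ → Σ (Cut A) λ ξmax →
    ∀ t → (∀ t' → flux A t' ξ ≤ flux A t ξ) → ¬ Trespasses A t ξmax
  max-flux-cut t₀ ξ = cut , untouched
    where
    t₁ = proj₁ (barrier-exists ξ t₀)
    B = proj₂ (barrier-exists ξ t₀)
    open Barrier B
    open Cut cut
    flux₁ : flux A t₁ cut ≡ 0ℤ
    flux₁ = trans (flux-barrier B t₁) (cong -_ (sum-zero len (λ i → cong ⟦_⟧ (unselected i))))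
    untouched : ∀ t → (∀ t' → flux A t' ξ ≤ flux A t ξ) → ¬ Trespasses A t cut
    untouched t maximal (i , trespass) = 1≢0
      (trans (sym (cong ⟦_⟧ trespass)) (sum-nonNeg-≤0⇒0 len {λ i → ⟦ sel t (edg i) ⟧} nonNeg total≤0 i))
      where
      1≢0 : 1ℤ ≢ 0ℤ
      1≢0 ()
      nonNeg : ∀ i → 0ℤ ≤ ⟦ sel t (edg i) ⟧
      nonNeg i with sel t (edg i)
      ... | true  = ℤ.+≤+ ℕ.z≤n
      ... | false = ℤ.+≤+ ℕ.z≤n
      0≤flux : 0ℤ ≤ flux A t cut
      -- Maximality is known relative to `ξ` and is carried over to `cut` through the flux
      -- difference with `t₁`.
      0≤flux = subst (0ℤ ≤_) (begin
        flux A t ξ - flux A t₁ ξ     ≡⟨ flux-difference-independent t₁ t ξ cut ⟩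
        flux A t cut - flux A t₁ cut ≡⟨ cong (λ z → flux A t cut - z) flux₁ ⟩
        flux A t cut - 0ℤ            ≡⟨ ℤ.+-identityʳ (flux A t cut) ⟩
        flux A t cut ∎) (ℤ.i≤j⇒0≤j-i (maximal t₁))
      total≤0 : sumℤ len (λ i → ⟦ sel t (edg i) ⟧) ≤ 0ℤ
      total≤0 = ℤ.neg-cancel-≤ (subst (0ℤ ≤_) (flux-barrier B t) 0≤flux)

-- Exchange of the two colours.

recolour : QuadComplex → QuadComplex
recolour A = record { QuadComplex A ; black = not ∘ QuadComplex.black A }

recolour-annulus : ∀ {A} → IsQuadAnnulus A → IsQuadAnnulus (recolour A)
recolour-annulus ann = record
  { IsQuadAnnulus ann
  ; colouring = λ f a g b eq f≢g same → IsQuadAnnulus.colouring ann f a g b eq f≢g (not-injective same) }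

-- Tilings and cuts do not mention colours; their records are rebuilt only because the complex is a
-- parameter of their types.
recolour-tiling : ∀ {A} → Tiling A → Tiling (recolour A)
recolour-tiling t = record { Tiling t }

uncolour-tiling : ∀ {A} → Tiling (recolour A) → Tiling A
uncolour-tiling t = record { Tiling t }

recolour-cut : ∀ {A} → Cut A → Cut (recolour A)
recolour-cut ξ = record { Cut ξ }

uncolour-cut : ∀ {A} → Cut (recolour A) → Cut A
uncolour-cut ξ = record { Cut ξ }

-- Exchanging the colours reverses every domino arrow.
recolour-flux : ∀ A t ξ → flux (recolour A) (recolour-tiling t) (recolour-cut ξ) ≡ - flux A t ξ
recolour-flux A t ξ = trans (sum-cong len (λ i → trans (sum-cong nF (λ f → trans
  (sum-cong 4 (λ a → negate (selected i f a) (black f))) (sum-neg 4 (λ a → weight i f a))))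
  (sum-neg nF (λ f → sumℤ 4 (weight i f)))))
  (sum-neg len (λ i → sumℤ nF (λ f → sumℤ 4 (weight i f))))
  where
  open QuadComplex A
  open Tiling t
  open Cut ξ
  selected : Fin len → Fin nF → Fin 4 → Bool
  selected i f a = sel (edg i) ∧ ⌊ side f a ≟ edg i ⌋ ∧ ⌊ corner f a ≟ vtx (inject₁ i) ⌋
  weight : Fin len → Fin nF → Fin 4 → ℤ
  weight i f a = if selected i f a then sign (black f) else 0ℤ
  negate : ∀ p c → (if p then sign (not c) else 0ℤ) ≡ - (if p then sign c else 0ℤ)
  negate true  true  = refl
  negate true  false = refl
  negate false c     = refl

theorem3p3 : (A : QuadComplex) → IsQuadAnnulus A → Tiling A → (ξ : Cut A) →
    (Σ (Cut A) λ ξmax → (t : Tiling A) → ((t' : Tiling A) → flux A t' ξ ≤ flux A t ξ) →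
    ¬ Trespasses A t ξmax)
    ×
    (Σ (Cut A) λ ξmin → (t : Tiling A) → ((t' : Tiling A) → flux A t ξ ≤ flux A t' ξ) →
    ¬ Trespasses A t ξmin)
theorem3p3 A ann t₀ ξ = Annulus.max-flux-cut A ann t₀ ξ ,
  -- A tiling of minimal flux has maximal flux after recolouring, and trespassing is the same in
  -- both complexes.
  let ξ' , untouched = Annulus.max-flux-cut (recolour A) (recolour-annulus ann) (recolour-tiling t₀) (recolour-cut ξ)
  in uncolour-cut ξ' , λ t minimal → untouched (recolour-tiling t) λ t' →
       subst₂ _≤_ (sym (recolour-flux A (uncolour-tiling t') ξ)) (sym (recolour-flux A t ξ))
         (ℤ.neg-mono-≤ (minimal (uncolour-tiling t')))
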